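{- For all $X,Y\in\mathbb{R}$ and all integers $p,q\geq1$, \begin{align*} \binom{p+q}{q}\mathcal{B}_{p}(X+Y)\mathcal{B}_{q}(Y) &=\sum_{j=0}^{p+q}\binom{p+q}{j}\binom{p+q-1-j}{q-1}\mathcal{B}_{p+q-j}(Y)\mathcal{B}_{j}(X)\\ &\quad+\sum_{h=0}^{q}\binom{p+q}{h}\binom{p+q-1-h}{p-1}(-1)^{h}\mathcal{B}_{p+q-h}(X+Y)\mathcal{B}_{h}(X). \end{align*}
   Context: $B_n(x)$ denotes the $n$th Bernoulli polynomial, defined by $\frac{te^{xt}}{e^t-1}=\sum_{n\ge0}B_n(x)\frac{t^n}{n!}$, and $\mathcal{B}_n(x)=B_n(x-[x])$ is the $n$th Bernoulli function, where $[x]$ is the largest integer $\le x$ (so $\mathcal{B}_0\equiv1$ and $\mathcal{B}_1(m)=-1/2$ for $m\in\mathbb{Z}$). Binomial coefficients with integer upper entry $n$ (possibly negative) and integer lower entry $k\ge0$ are $\binom{n}{k}=\frac{n(n-1)\cdots(n-k+1)}{k!}$; in particular $\binom{ -1}{k}=(-1)^k$ and $\binom{n}{k}=0$ for $0\le n<k$. -}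

module Defs where

open import Algebra.Bundles using (CommutativeRing; Semiring)
import Algebra.Definitions.RawSemiring
import Algebra.Properties.Semiring.Sum
open import Data.Empty using (⊥)
open import Data.Fin.Base as Fin using (Fin; toℕ)
open import Data.Integer.Base as ℤ using (ℤ; +_; -[1+_]; 1ℤ)
import Data.Integer.Properties as ℤ
open import Data.Nat.Base as ℕ using (ℕ; zero; suc; _!; _⊔_; _∸_)
import Data.Nat.Coprimality as Coprimality
import Data.Nat.Properties as ℕ
open import Data.Product.Base using (Σ; ∃; _×_; _,_; proj₁; proj₂)
open import Data.Rational.Base as ℚ using (ℚ; 0ℚ; 1ℚ; ½; ∣_∣; _/_; mkℚ; *≤*; *<*)
import Data.Rational.Properties as ℚ
import Data.Rational.Solver
open import Data.Sum.Base using (inj₁; inj₂)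
open import Data.Vec.Base as Vec using (Vec; []; _∷_; lookup)
open import Level using (0ℓ)
open import Relation.Binary.PropositionalEquality
open import Relation.Binary.Structures using (IsEquivalence)
import Relation.Binary.Reasoning.Setoid
open import Relation.Nullary.Decidable.Core using (yes; no)
open import Relation.Nullary.Negation.Core using (¬_; contradiction)

open Data.Rational.Solver.+-*-Solver

------------------------------------------------------------------------
-- Families of rationals tending to 0; `L N i` says that the index i is
-- at least N.

module Limits {I : Set} (L : ℕ → I → Set)
              (anti : ∀ {M N i} → M ℕ.≤ N → L N i → L M i) where

  Null : (I → ℚ) → Set
  Null f = ∀ ε → 0ℚ ℚ.< ε → ∃ λ N → ∀ i → L N i → ∣ f i ∣ ℚ.< ε

  Bounded : (I → ℚ) → Set
  Bounded f = Σ ℚ λ B → 0ℚ ℚ.< B × ∃ λ N → ∀ i → L N i → ∣ f i ∣ ℚ.≤ B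

  null-resp : ∀ {f g} → (∀ i → f i ≡ g i) → Null f → Null g
  null-resp e nf ε ε>0 with nf ε ε>0
  ... | N , h = N , λ i l → subst (λ z → ∣ z ∣ ℚ.< ε) (e i) (h i l)

  null-0 : Null (λ _ → 0ℚ)
  null-0 ε ε>0 = 0 , λ _ _ → ε>0

  null-+ : ∀ {f g} → Null f → Null g → Null (λ i → f i ℚ.+ g i)
  null-+ {f} {g} nf ng ε ε>0 = M ⊔ N , λ i l →
    ℚ.≤-<-trans (ℚ.∣p+q∣≤∣p∣+∣q∣ (f i) (g i))
      (subst (∣ f i ∣ ℚ.+ ∣ g i ∣ ℚ.<_) halves
        (ℚ.+-mono-< (proj₂ F i (anti (ℕ.m≤m⊔n M N) l))
                    (proj₂ G i (anti (ℕ.m≤n⊔m M N) l))))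
    where
    δ = ½ ℚ.* ε
    δ>0 : 0ℚ ℚ.< δ
    δ>0 = ℚ.positive⁻¹ δ {{ℚ.pos*pos⇒pos ½ ε {{ℚ.positive ε>0}}}}
    halves : δ ℚ.+ δ ≡ ε
    halves = trans (sym (ℚ.*-distribʳ-+ ε ½ ½)) (ℚ.*-identityˡ ε)
    F = nf δ δ>0
    G = ng δ δ>0
    M = proj₁ F
    N = proj₁ G

  null-neg : ∀ {f} → Null f → Null (λ i → ℚ.- f i)
  null-neg {f} nf ε ε>0 with nf ε ε>0
  ... | N , h = N , λ i l → subst (ℚ._< ε) (sym (ℚ.∣-p∣≡∣p∣ (f i))) (h i l)

  null-* : ∀ {b f} → Bounded b → Null f → Null (λ i → b i ℚ.* f i)
  null-* {b} {f} (B , B>0 , M , hb) nf ε ε>0 = M ⊔ N , λ i l →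
    ℚ.≤-<-trans (ℚ.≤-reflexive (ℚ.∣p*q∣≡∣p∣*∣q∣ (b i) (f i)))
      (ℚ.≤-<-trans
        (ℚ.*-monoʳ-≤-nonNeg ∣ f i ∣ {{ℚ.∣-∣-nonNeg (f i)}}
          (hb i (anti (ℕ.m≤m⊔n M N) l)))
        (subst (B ℚ.* ∣ f i ∣ ℚ.<_) cancel
          (ℚ.*-monoʳ-<-pos B (proj₂ F i (anti (ℕ.m≤n⊔m M N) l)))))
    where
    instance
      B-pos : ℚ.Positive B
      B-pos = ℚ.positive B>0
      B≢0 : ℚ.NonZero B
      B≢0 = ℚ.pos⇒nonZero B
    δ = ℚ.1/ B ℚ.* ε
    δ>0 : 0ℚ ℚ.< δ
    δ>0 = ℚ.positive⁻¹ δ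
      {{ℚ.pos*pos⇒pos (ℚ.1/ B) {{ℚ.1/pos⇒pos B}} ε {{ℚ.positive ε>0}}}}
    cancel : B ℚ.* δ ≡ ε
    cancel = trans (sym (ℚ.*-assoc B (ℚ.1/ B) ε))
      (trans (cong (ℚ._* ε) (ℚ.*-inverseʳ B)) (ℚ.*-identityˡ ε))
    F = nf δ δ>0
    N = proj₁ F

module L₁ = Limits ℕ._≤_ ℕ.≤-trans
module L₂ = Limits {ℕ × ℕ} (λ N (m , n) → N ℕ.≤ m × N ℕ.≤ n)
  (λ M≤N (p , q) → ℕ.≤-trans M≤N p , ℕ.≤-trans M≤N q)

------------------------------------------------------------------------
-- Real numbers: Cauchy sequences of rationals, with the equality that
-- identifies sequences whose difference tends to 0

record ℝ : Set where
  constructor mkℝ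
  field
    seq    : ℕ → ℚ
    cauchy : ∀ ε → 0ℚ ℚ.< ε →
             ∃ λ N → ∀ m n → N ℕ.≤ m → N ℕ.≤ n → ∣ seq m ℚ.- seq n ∣ ℚ.< ε

open ℝ public

infix 4 _≈_ _≤_

record _≈_ (x y : ℝ) : Set where
  constructor mk≈
  field
    small : ∀ ε → 0ℚ ℚ.< ε →
            ∃ λ N → ∀ n → N ℕ.≤ n → ∣ seq x n ℚ.- seq y n ∣ ℚ.< ε

open _≈_ public

record _≤_ (x y : ℝ) : Set where
  constructor mk≤
  field
    bound : ∀ ε → 0ℚ ℚ.< ε →
            ∃ λ N → ∀ n → N ℕ.≤ n → seq x n ℚ.- seq y n ℚ.< ε

open _≤_ public

diff₂ : (ℕ → ℚ) → ℕ × ℕ → ℚ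
diff₂ f (m , n) = f m ℚ.- f n

uncauchy : ∀ x → L₂.Null (diff₂ (seq x))
uncauchy x ε ε>0 with cauchy x ε ε>0
... | N , h = N , λ (m , n) (p , q) → h m n p q

real : (f : ℕ → ℚ) → L₂.Null (diff₂ f) → ℝ
real f nf .seq = f
real f nf .cauchy ε ε>0 with nf ε ε>0
... | N , h = N , λ m n p q → h (m , n) (p , q)

-- The bounds and Cauchy conditions are abstract so that they are never
-- unfolded when reals are compared.
abstract
  bounded : ∀ x → L₁.Bounded (seq x)
  bounded x with cauchy x 1ℚ (ℚ.positive⁻¹ 1ℚ)
  ... | N , h = ∣ seq x N ∣ ℚ.+ 1ℚ
    , ℚ.+-mono-≤-< (ℚ.0≤∣p∣ (seq x N)) (ℚ.positive⁻¹ 1ℚ)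
    , N , λ n N≤n →
      ℚ.≤-trans (ℚ.≤-reflexive (cong ∣_∣ (split (seq x n) (seq x N))))
        (ℚ.≤-trans (ℚ.∣p+q∣≤∣p∣+∣q∣ (seq x N) (seq x n ℚ.- seq x N))
          (ℚ.+-monoʳ-≤ ∣ seq x N ∣ (ℚ.<⇒≤ (h n N N≤n ℕ.≤-refl))))
    where
    split : ∀ a b → a ≡ b ℚ.+ (a ℚ.- b)
    split = solve 2 (λ a b → a := b :+ (a :- b)) refl

  bounded-fst : ∀ x → L₂.Bounded (λ (m , _) → seq x m)
  bounded-fst x = let B , B>0 , N , h = bounded x in
    B , B>0 , N , λ (m , _) (p , _) → h m p

  bounded-snd : ∀ x → L₂.Bounded (λ (_ , n) → seq x n)
  bounded-snd x = let B , B>0 , N , h = bounded x in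
    B , B>0 , N , λ (_ , n) (_ , q) → h n q

  const-cauchy : ∀ a → L₂.Null (diff₂ (λ _ → a))
  const-cauchy a = L₂.null-resp (λ _ → sym (ℚ.+-inverseʳ a)) L₂.null-0

  +-cauchy : ∀ x y → L₂.Null (diff₂ (λ n → seq x n ℚ.+ seq y n))
  +-cauchy x y =
    L₂.null-resp (λ (m , n) → arrange (seq x m) (seq x n) (seq y m) (seq y n))
      (L₂.null-+ (uncauchy x) (uncauchy y))
    where
    arrange : ∀ a b c d → (a ℚ.- b) ℚ.+ (c ℚ.- d) ≡ (a ℚ.+ c) ℚ.- (b ℚ.+ d)
    arrange = solve 4 (λ a b c d → (a :- b) :+ (c :- d) := (a :+ c) :- (b :+ d)) refl

  neg-cauchy : ∀ x → L₂.Null (diff₂ (λ n → ℚ.- seq x n))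
  neg-cauchy x =
    L₂.null-resp (λ (m , n) → ℚ.neg-distrib-+ (seq x m) (ℚ.- seq x n))
      (L₂.null-neg (uncauchy x))

  *-cauchy : ∀ x y → L₂.Null (diff₂ (λ n → seq x n ℚ.* seq y n))
  *-cauchy x y =
    L₂.null-resp (λ (m , n) → arrange (seq x m) (seq x n) (seq y m) (seq y n))
      (L₂.null-+ (L₂.null-* (bounded-fst x) (uncauchy y))
                 (L₂.null-* (bounded-snd y) (uncauchy x)))
    where
    arrange : ∀ a b c d →
      a ℚ.* (c ℚ.- d) ℚ.+ d ℚ.* (a ℚ.- b) ≡ a ℚ.* c ℚ.- b ℚ.* d
    arrange = solve 4 (λ a b c d →
      a :* (c :- d) :+ d :* (a :- b) := a :* c :- b :* d) refl

fromℚ : ℚ → ℝ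
fromℚ a = real (λ _ → a) (const-cauchy a)

fromℤ : ℤ → ℝ
fromℤ i = fromℚ (i / 1)

infixl 6 _+_ _-_
infixl 7 _*_
infix  8 -_

_+_ : ℝ → ℝ → ℝ
x + y = real (λ n → seq x n ℚ.+ seq y n) (+-cauchy x y)

-_ : ℝ → ℝ
- x = real (λ n → ℚ.- seq x n) (neg-cauchy x)

_-_ : ℝ → ℝ → ℝ
x - y = x + - y

_*_ : ℝ → ℝ → ℝ
x * y = real (λ n → seq x n ℚ.* seq y n) (*-cauchy x y)

pointwise : ∀ {x y} → (∀ n → seq x n ≡ seq y n) → x ≈ y
pointwise {x} {y} e = mk≈ (L₁.null-resp
  (λ n → sym (trans (cong (ℚ._- seq y n) (e n)) (ℚ.+-inverseʳ (seq y n))))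
  L₁.null-0)

≈-isEquivalence : IsEquivalence _≈_
≈-isEquivalence = record
  { refl  = λ {x} → pointwise {x} {x} (λ _ → refl)
  ; sym   = λ {x} {y} e → mk≈ (L₁.null-resp
      (λ n → flip (seq x n) (seq y n)) (L₁.null-neg (small e)))
  ; trans = λ {x} {y} {z} e f → mk≈ (L₁.null-resp
      (λ n → chain (seq x n) (seq y n) (seq z n)) (L₁.null-+ (small e) (small f)))
  }
  where
  flip : ∀ a b → ℚ.- (a ℚ.- b) ≡ b ℚ.- a
  flip = solve 2 (λ a b → :- (a :- b) := b :- a) refl
  chain : ∀ a b c → (a ℚ.- b) ℚ.+ (b ℚ.- c) ≡ a ℚ.- c
  chain = solve 3 (λ a b c → (a :- b) :+ (b :- c) := a :- c) refl

ℝ-commutativeRing : CommutativeRing 0ℓ 0ℓ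
ℝ-commutativeRing = record
  { Carrier = ℝ ; _≈_ = _≈_ ; _+_ = _+_ ; _*_ = _*_ ; -_ = -_
  ; 0# = fromℚ 0ℚ ; 1# = fromℚ 1ℚ
  ; isCommutativeRing = record
    { isRing = record
      { +-isAbelianGroup = record
        { isGroup = record
          { isMonoid = record
            { isSemigroup = record
              { isMagma = record
                { isEquivalence = ≈-isEquivalence
                ; ∙-cong = λ {x} {y} {u} {v} e f → mk≈ (L₁.null-resp
                    (λ n → cong-+ (seq x n) (seq y n) (seq u n) (seq v n))
                    (L₁.null-+ (small e) (small f)))
                }
              ; assoc = λ x y z → pointwise {(x + y) + z} {x + (y + z)}
                  λ n → ℚ.+-assoc (seq x n) (seq y n) (seq z n)
              }
            ; identity = (λ x → pointwise {_ + x} {x} λ n → ℚ.+-identityˡ (seq x n))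
                       , (λ x → pointwise {x + _} {x} λ n → ℚ.+-identityʳ (seq x n))
            }
          ; inverse = (λ x → pointwise {(- x) + x} {fromℚ 0ℚ} λ n → ℚ.+-inverseˡ (seq x n))
                    , (λ x → pointwise {x + (- x)} {fromℚ 0ℚ} λ n → ℚ.+-inverseʳ (seq x n))
          ; ⁻¹-cong = λ {x} {y} e → mk≈ (L₁.null-resp
              (λ n → ℚ.neg-distrib-+ (seq x n) (ℚ.- seq y n)) (L₁.null-neg (small e)))
          }
        ; comm = λ x y → pointwise {x + y} {y + x} λ n → ℚ.+-comm (seq x n) (seq y n)
        }
      ; *-cong = λ {x} {y} {u} {v} e f → mk≈ (L₁.null-resp
          (λ n → cong-* (seq x n) (seq y n) (seq u n) (seq v n))
          (L₁.null-+ (L₁.null-* (bounded x) (small f)) (L₁.null-* (bounded v) (small e))))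
      ; *-assoc = λ x y z → pointwise {(x * y) * z} {x * (y * z)}
          λ n → ℚ.*-assoc (seq x n) (seq y n) (seq z n)
      ; *-identity = (λ x → pointwise {_ * x} {x} λ n → ℚ.*-identityˡ (seq x n))
                   , (λ x → pointwise {x * _} {x} λ n → ℚ.*-identityʳ (seq x n))
      ; distrib = (λ x y z → pointwise {x * (y + z)} {x * y + x * z}
                    λ n → ℚ.*-distribˡ-+ (seq x n) (seq y n) (seq z n))
                , (λ x y z → pointwise {(y + z) * x} {y * x + z * x}
                    λ n → ℚ.*-distribʳ-+ (seq x n) (seq y n) (seq z n))
      }
    ; *-comm = λ x y → pointwise {x * y} {y * x} λ n → ℚ.*-comm (seq x n) (seq y n)
    }
  }
  where
  cong-+ : ∀ a b c d → (a ℚ.- b) ℚ.+ (c ℚ.- d) ≡ (a ℚ.+ c) ℚ.- (b ℚ.+ d)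
  cong-+ = solve 4 (λ a b c d → (a :- b) :+ (c :- d) := (a :+ c) :- (b :+ d)) refl
  cong-* : ∀ a b c d →
    a ℚ.* (c ℚ.- d) ℚ.+ d ℚ.* (a ℚ.- b) ≡ a ℚ.* c ℚ.- b ℚ.* d
  cong-* = solve 4 (λ a b c d →
    a :* (c :- d) :+ d :* (a :- b) := a :* c :- b :* d) refl

module R = CommutativeRing ℝ-commutativeRing

open R public using (0#; 1#)
open Algebra.Definitions.RawSemiring (Semiring.rawSemiring R.semiring) public
  using (_^_; sum)

∑≤ : ℕ → (ℕ → ℝ) → ℝ
∑≤ n f = sum {suc n} (λ i → f (toℕ i))

infixl 10 ∑≤
syntax ∑≤ n (λ j → e) = ∑[ j ≤ n ] e

------------------------------------------------------------------------
-- Integer part.  Constructively there is no function ℝ → ℤ computing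
-- [x], so it is given by its defining property; `floor-unique` and
-- `floor-exists` show that every real has exactly one (existence being
-- classical, hence the double negation).

IsFloor : ℝ → ℤ → Set
IsFloor x m = fromℤ m ≤ x × (∀ k → fromℤ k ≤ x → k ℤ.≤ m)

Floor : ℝ → Set
Floor x = ∃ (IsFloor x)

floor-unique : ∀ x (f g : Floor x) → proj₁ f ≡ proj₁ g
floor-unique x (m , m≤x , m-max) (n , n≤x , n-max) =
  ℤ.≤-antisym (n-max m m≤x) (m-max n n≤x)

/1 : ∀ i → i / 1 ≡ mkℚ i 0 (Coprimality.sym (Coprimality.1-coprimeTo ℤ.∣ i ∣))
/1 i = ℚ.↥p/↧p≡p (mkℚ i 0 (Coprimality.sym (Coprimality.1-coprimeTo ℤ.∣ i ∣)))

/1-mono : ∀ {i j} → i ℤ.≤ j → i / 1 ℚ.≤ j / 1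
/1-mono {i} {j} i≤j = subst₂ ℚ._≤_ (sym (/1 i)) (sym (/1 j))
  (*≤* (ℤ.*-monoʳ-≤-nonNeg 1ℤ i≤j))

/1-mono-< : ∀ {i j} → i ℤ.< j → i / 1 ℚ.< j / 1
/1-mono-< {i} {j} i<j = subst₂ ℚ._<_ (sym (/1 i)) (sym (/1 j))
  (*<* (ℤ.*-monoʳ-<-pos 1ℤ i<j))

-- a positive rational is at most its numerator
ceil : ∀ B → 0ℚ ℚ.< B → ∃ λ K → B ℚ.≤ (+ K) / 1
ceil (mkℚ (+ K) d c) _ = K , subst (mkℚ (+ K) d c ℚ.≤_) (sym (/1 (+ K)))
  (*≤* (ℤ.*-monoˡ-≤-nonNeg (+ K) (ℤ.+≤+ (ℕ.s≤s ℕ.z≤n))))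
ceil (mkℚ -[1+ _ ] _ _) (*<* ())

p≤∣p∣ : ∀ p → p ℚ.≤ ∣ p ∣
p≤∣p∣ p with ℚ.≤-total 0ℚ p
... | inj₁ 0≤p = ℚ.≤-reflexive (sym (ℚ.0≤p⇒∣p∣≡p 0≤p))
... | inj₂ p≤0 = ℚ.≤-trans p≤0 (ℚ.0≤∣p∣ p)

fromℤ-≤ : ∀ {i j x} → i ℤ.≤ j → fromℤ j ≤ x → fromℤ i ≤ x
fromℤ-≤ {x = x} i≤j j≤x .bound ε ε>0 with bound j≤x ε ε>0
... | N , h = N , λ n N≤n →
  ℚ.≤-<-trans (ℚ.+-monoˡ-≤ (ℚ.- seq x n) (/1-mono i≤j)) (h n N≤n)

record IntegerBound (x : ℝ) : Set where
  field
    K N : ℕ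
    ∣x∣≤K : ∀ n → N ℕ.≤ n → ∣ seq x n ∣ ℚ.≤ (+ K) / 1

abstract
  integerBound : ∀ x → IntegerBound x
  integerBound x =
    let B , B>0 , N , h = bounded x
        K , B≤K = ceil B B>0
    in record { K = K ; N = N ; ∣x∣≤K = λ n N≤n → ℚ.≤-trans (h n N≤n) B≤K }

below : ∀ x → ∃ λ a → fromℤ a ≤ x
below x = ℤ.- (+ K) , mk≤ λ ε ε>0 → N , λ n N≤n → ℚ.≤-<-trans (lem n N≤n) ε>0
  where
  open IntegerBound (integerBound x)
  neg-/1 : ∀ k → (ℤ.- (+ k)) / 1 ≡ ℚ.- ((+ k) / 1)
  neg-/1 zero    = refl
  neg-/1 (suc k) = refl
  lem : ∀ n → N ℕ.≤ n → (ℤ.- (+ K)) / 1 ℚ.- seq x n ℚ.≤ 0ℚ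
  lem n N≤n = begin
    (ℤ.- (+ K)) / 1 ℚ.- seq x n    ≡⟨ cong (ℚ._- seq x n) (neg-/1 K) ⟩
    ℚ.- ((+ K) / 1) ℚ.- seq x n    ≤⟨ ℚ.+-monoʳ-≤ (ℚ.- ((+ K) / 1)) -x≤K ⟩
    ℚ.- ((+ K) / 1) ℚ.+ (+ K) / 1  ≡⟨ ℚ.+-inverseˡ ((+ K) / 1) ⟩
    0ℚ ∎
    where
    open ℚ.≤-Reasoning
    -x≤K : ℚ.- seq x n ℚ.≤ (+ K) / 1
    -x≤K = ℚ.≤-trans (p≤∣p∣ (ℚ.- seq x n))
      (ℚ.≤-trans (ℚ.≤-reflexive (ℚ.∣-p∣≡∣p∣ (seq x n))) (∣x∣≤K n N≤n))

above : ∀ x → ∃ λ b → ¬ (fromℤ b ≤ x)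
above x = + suc K , λ K+1≤x → absurd (bound K+1≤x gap gap>0)
  where
  open IntegerBound (integerBound x)
  gap : ℚ
  gap = (+ suc K) / 1 ℚ.- (+ K) / 1
  gap>0 : 0ℚ ℚ.< gap
  gap>0 = subst (ℚ._< gap) (ℚ.+-inverseʳ ((+ K) / 1))
    (ℚ.+-monoˡ-< (ℚ.- ((+ K) / 1)) (/1-mono-< (ℤ.+<+ (ℕ.n<1+n K))))
  absurd : (∃ λ M → ∀ n → M ℕ.≤ n → (+ suc K) / 1 ℚ.- seq x n ℚ.< gap) → ⊥
  absurd (M , g) = ℚ.<-irrefl refl
    (ℚ.<-≤-trans (g (M ⊔ N) (ℕ.m≤m⊔n M N))
      (ℚ.+-monoʳ-≤ ((+ suc K) / 1) (ℚ.neg-antimono-≤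
        (ℚ.≤-trans (p≤∣p∣ (seq x (M ⊔ N))) (∣x∣≤K (M ⊔ N) (ℕ.m≤n⊔m M N))))))

floor-exists : ∀ x → ¬ ¬ Floor x
floor-exists x ¬floor = climb ℤ.∣ b ℤ.- a ∣ λ le → b≰x (fromℤ-≤ {x = x} reach le)
  where
  a b : ℤ
  a = proj₁ (below x)
  b = proj₁ (above x)
  a≤x : fromℤ a ≤ x
  a≤x = proj₂ (below x)
  b≰x : ¬ (fromℤ b ≤ x)
  b≰x = proj₂ (above x)
  step : ∀ {m} → fromℤ m ≤ x → ¬ ¬ (fromℤ (ℤ.suc m) ≤ x)
  step {m} m≤x ¬le = ¬floor (m , m≤x , max)
    where
    max : ∀ k → fromℤ k ≤ x → k ℤ.≤ m
    max k k≤x with k ℤ.≤? m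
    ... | yes k≤m = k≤m
    ... | no  k≰m = contradiction (fromℤ-≤ {x = x} (ℤ.i<j⇒suc[i]≤j (ℤ.≰⇒> k≰m)) k≤x) ¬le
  climb : ∀ n → ¬ ¬ (fromℤ (+ n ℤ.+ a) ≤ x)
  climb zero    ¬le = ¬le (subst (λ i → fromℤ i ≤ x) (sym (ℤ.+-identityˡ a)) a≤x)
  climb (suc n) ¬le = climb n λ le → step {+ n ℤ.+ a} le λ le′ →
    ¬le (subst (λ i → fromℤ i ≤ x) (sym (ℤ.+-assoc 1ℤ (+ n) a)) le′)
  i≤∣i∣ : ∀ i → i ℤ.≤ + ℤ.∣ i ∣
  i≤∣i∣ (+ n)    = ℤ.≤-refl
  i≤∣i∣ -[1+ n ] = ℤ.-≤+
  reach : b ℤ.≤ + ℤ.∣ b ℤ.- a ∣ ℤ.+ a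
  reach = subst (ℤ._≤ + ℤ.∣ b ℤ.- a ∣ ℤ.+ a)
    (trans (ℤ.+-assoc b (ℤ.- a) a)
      (trans (cong (λ z → b ℤ.+ z) (ℤ.+-inverseˡ a)) (ℤ.+-identityʳ b)))
    (ℤ.+-monoˡ-≤ a (i≤∣i∣ (b ℤ.- a)))

------------------------------------------------------------------------
-- Formal power series in t, given by their coefficients

Series : Set
Series = ℕ → ℝ

infixl 7 _⊛_ _⊘_
infixl 6 _⊖_

_⊛_ : Series → Series → Series
(f ⊛ g) n = ∑[ k ≤ n ] (f k * g (n ∸ k))

_⊖_ : Series → Series → Series
(f ⊖ g) n = f n - g n

one : Series
one zero    = 1#
one (suc _) = 0#

t·_ : Series → Series
(t· f) zero    = 0#
(t· f) (suc n) = f n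

1/! : ℕ → ℝ
1/! n = fromℚ ((+ 1 / (n !)) {{ n ℕ.!≢0 }})

-- e^{xt}
exp : ℝ → Series
exp x n = x ^ n * 1/! n

-- Division by a series d with d 0 ≈ 1.  `quotients a d n` lists the
-- coefficients of a/d of index n-1, …, 0.
quotients : Series → Series → (n : ℕ) → Vec ℝ n
quotients a d zero    = []
quotients a d (suc n) =
  (a n - sum (λ i → d (suc (toℕ i)) * lookup qs i)) ∷ qs
  where qs = quotients a d n

_⊘_ : Series → Series → Series
(a ⊘ d) n = Vec.head (quotients a d (suc n))

-- t e^{xt} / (e^t - 1) = e^{xt} / ((e^t - 1) / t)
bernoulliSeries : ℝ → Series
bernoulliSeries x = exp x ⊘ (λ n → exp 1# (suc n))

-- B_n(x) is n! times the coefficient of t^n.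
B : ℕ → ℝ → ℝ
B n x = fromℤ (+ (n !)) * bernoulliSeries x n

-- (e^t - 1) ∑ B_n(x) t^n / n! = t e^{xt}
generatingFunction : ∀ x n →
  ((exp 1# ⊖ one) ⊛ (λ k → B k x * 1/! k)) n ≈ (t· exp x) n
generatingFunction x = proof
  where
  open Relation.Binary.Reasoning.Setoid R.setoid
  open Algebra.Properties.Semiring.Sum R.semiring using (sum-cong-≋)

  d q b : Series
  d k = exp 1# (suc k)
  q = bernoulliSeries x
  b k = B k x * 1/! k

  /!-cancel : ∀ k → fromℤ (+ (k !)) * 1/! k ≈ 1#
  /!-cancel k = pointwise {fromℤ (+ (k !)) * 1/! k} {1#} λ _ → inv (k !) {{k ℕ.!≢0}}
    where
    inv : ∀ m .{{_ : ℕ.NonZero m}} → (+ m) / 1 ℚ.* (+ 1 / m) ≡ 1ℚ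
    inv m@(suc _) = trans (cong₂ ℚ._*_ (/1 (+ m)) (ℚ.↥p/↧p≡p p))
      (ℚ.*-inverseʳ (mkℚ (+ m) 0 (Coprimality.sym (Coprimality.1-coprimeTo m))))
      where
      p = mkℚ (+ 1) (ℕ.pred m) (Coprimality.1-coprimeTo m)

  b≈q : ∀ k → b k ≈ q k
  b≈q k = begin
    (fromℤ (+ (k !)) * q k) * 1/! k  ≈⟨ R.*-congʳ (R.*-comm _ _) ⟩
    (q k * fromℤ (+ (k !))) * 1/! k  ≈⟨ R.*-assoc _ _ _ ⟩
    q k * (fromℤ (+ (k !)) * 1/! k)  ≈⟨ R.*-congˡ (/!-cancel k) ⟩
    q k * 1#                         ≈⟨ R.*-identityʳ _ ⟩
    q k                              ∎

  lookup-quotients : ∀ n (i : Fin n) →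
    lookup (quotients (exp x) d n) i ≡ q (n ∸ suc (toℕ i))
  lookup-quotients (suc n) Fin.zero    = refl
  lookup-quotients (suc n) (Fin.suc i) = lookup-quotients n i

  e₀ : (exp 1# ⊖ one) 0 ≈ 0#
  e₀ = pointwise {(exp 1# ⊖ one) 0} {0#} λ _ → refl

  d₀ : d 0 ≈ 1#
  d₀ = pointwise {d 0} {1#} λ _ → refl

  recurrence : ∀ n → sum {suc n} (λ i → d (toℕ i) * q (n ∸ toℕ i)) ≈ exp x n
  recurrence n = begin
    d 0 * q n + tail               ≈⟨ R.+-congʳ (R.trans (R.*-congʳ d₀) (R.*-identityˡ _)) ⟩
    (exp x n - tail′) + tail       ≈⟨ R.+-congˡ (sum-cong-≋ {n} λ i →
                                        R.*-congˡ {d (suc (toℕ i))} (R.reflexive (sym (lookup-quotients n i)))) ⟩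
    (exp x n - tail′) + tail′      ≈⟨ R.+-assoc _ _ _ ⟩
    exp x n + ((- tail′) + tail′)  ≈⟨ R.+-congˡ (R.-‿inverseˡ tail′) ⟩
    exp x n + 0#                   ≈⟨ R.+-identityʳ _ ⟩
    exp x n                        ∎
    where
    tail tail′ : ℝ
    tail  = sum {n} (λ i → d (suc (toℕ i)) * q (n ∸ suc (toℕ i)))
    tail′ = sum {n} (λ i → d (suc (toℕ i)) * lookup (quotients (exp x) d n) i)

  proof : ∀ n → ((exp 1# ⊖ one) ⊛ b) n ≈ (t· exp x) n
  proof zero = begin
    (exp 1# ⊖ one) 0 * b 0 + 0#  ≈⟨ R.+-identityʳ _ ⟩
    (exp 1# ⊖ one) 0 * b 0       ≈⟨ R.*-congʳ e₀ ⟩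
    0# * b 0                     ≈⟨ R.zeroˡ _ ⟩
    0#                           ∎
  proof (suc n) = begin
    (exp 1# ⊖ one) 0 * b (suc n)
      + sum {suc n} (λ i → (d (toℕ i) - 0#) * b (n ∸ toℕ i))
        ≈⟨ R.+-cong (R.trans (R.*-congʳ e₀) (R.zeroˡ _))
             (sum-cong-≋ {suc n} λ i → R.*-cong
               (pointwise {d (toℕ i) - 0#} {d (toℕ i)} λ k → ℚ.+-identityʳ _)
               (b≈q (n ∸ toℕ i))) ⟩
    0# + sum {suc n} (λ i → d (toℕ i) * q (n ∸ toℕ i))
        ≈⟨ R.+-identityˡ _ ⟩
    sum {suc n} (λ i → d (toℕ i) * q (n ∸ toℕ i))
        ≈⟨ recurrence n ⟩
    exp x n ∎

-- 𝓑_n(x) = B_n(x - [x])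
𝓑 : ℕ → (x : ℝ) → Floor x → ℝ
𝓑 n x (m , _) = B n (x - fromℤ m)

------------------------------------------------------------------------
-- n(n-1)⋯(n-k+1)

fallingFactorial : ℤ → ℕ → ℤ
fallingFactorial n zero    = 1ℤ
fallingFactorial n (suc k) = fallingFactorial n k ℤ.* (n ℤ.- + k)

binom : ℤ → ℕ → ℝ
binom n k = fromℚ ((fallingFactorial n k / (k !)) {{ k ℕ.!≢0 }})

{-# OPTIONS --safe #-}

-- Let G(x,t) = t e^{xt}/(e^t - 1), and let x, y, z be the fractional parts of X, Y, X + Y.
-- Then z = x + y or z = x + y - 1, and in both cases
--
--   (s + t) G(z,s) G(y,t) = t G(y,s+t) G(x,s) + s G(z,s+t) G(x,-t),
--
-- because after clearing denominators this is an identity between exponentials.  With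
-- b_n = B_n/n!, the coefficient of s^{p+1} t^q expresses b_p(z) b_q(y) + b_{p+1}(z) b_{q-1}(y)
-- by sums whose coefficients are binomials, and the formula for b_p(z) b_q(y) follows from
-- Pascal's rule by induction on q.
module Submission where

open import Algebra.Bundles using (CommutativeRing)
open import Algebra.Morphism.Structures using (IsRingHomomorphism)
import Algebra.Properties.CommutativeMonoid.Mult
import Algebra.Properties.CommutativeSemigroup
import Algebra.Properties.Ring
import Algebra.Properties.Semiring.Exp
import Algebra.Properties.Semiring.Mult
import Algebra.Properties.Semiring.Sum
import Algebra.Solver.Ring.NaturalCoefficients.Default
open import Data.Empty using (⊥-elim)
open import Data.Fin.Base using (toℕ)
open import Data.Fin.Properties using (toℕ≤pred[n])
open import Data.Integer.Base as ℤ using (ℤ; +_; 0ℤ; 1ℤ) renaming (_-_ to _-ℤ_)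
import Data.Integer.Properties as ℤ
import Data.Integer.Solver
open import Data.Nat.Base as ℕ using (ℕ; zero; suc; _∸_; _!; _⊔_; z≤n; s≤s) renaming (_+_ to _+ℕ_; _≤_ to _≤ℕ_)
import Data.Nat.Properties as ℕ
open import Data.Product.Base using (∃; _,_)
open import Data.Rational.Base as ℚ using (ℚ; 0ℚ; 1ℚ; ½; _/_; fromℚᵘ)
import Data.Rational.Properties as ℚ
import Data.Rational.Solver
import Data.Rational.Unnormalised.Base as ℚᵘ
import Data.Rational.Unnormalised.Properties as ℚᵘ
open import Data.Sum.Base using (_⊎_; inj₁; inj₂)
import Defs
open Defs using (fallingFactorial)
open import Relation.Binary.PropositionalEquality as ≡ using (_≡_; cong; cong₂)
import Relation.Binary.Reasoning.Setoid
open import Relation.Nullary.Decidable.Core using (yes; no)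
open import Relation.Nullary.Negation.Core using (¬_)

-- The obstacle is that e^t - 1 has no inverse among power series. The proof therefore uses a
-- Bernoulli series only through (e^t - 1) F = t e^{xt}: the denominators are traded for the factors
-- s, t and s + t with the help of t/(e^t - 1), and these factors are cancelled, which needs only
-- that `suc n × x` determines `x`. Exponential coefficients carry the argument up to that point
-- because there e^{xt} is the sequence of powers of x, substituting s + t is the bare reindexing
-- `F (m +ℕ n)`, and product laws follow by induction from the Leibniz rule without any binomial
-- sum. A series in s and t is a series in s over the ring of series in t, so the construction is
-- made over an arbitrary commutative ring and applied twice. Binomial coefficients appear only on
-- the return to b_n = B_n/n!, where G(y,s+t) and G(z,s+t) produce them. The factor G(x,-t) is read
-- as G(1-x,t), which makes every numerator an explicit exponential.

-- The ring of exponential power series.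

-- A series ∑ F n tⁿ/n! is represented by its exponential coefficients F.  Then d/dt is the
-- shift D, and the product is determined by its constant term and the Leibniz rule.
module Hurwitz {c ℓ} (R : CommutativeRing c ℓ) where
  open CommutativeRing R hiding (zero)
  open Algebra.Properties.Semiring.Mult semiring using (_×_)
  open Algebra.Solver.Ring.NaturalCoefficients.Default commutativeSemiring
    using (solve; _:=_; _:+_)
  open Relation.Binary.Reasoning.Setoid setoid

  Series : Set c
  Series = ℕ → Carrier

  infix  4 _≋_
  infixl 7 _⊠_
  infixl 6 _⊕_

  _≋_ : Series → Series → Set ℓ
  F ≋ G = ∀ n → F n ≈ G n

  D : Series → Series
  D F n = F (suc n)

  _⊕_ : Series → Series → Series
  (F ⊕ G) n = F n + G n

  _⊠_ : Series → Series → Series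
  (F ⊠ G) zero    = F 0 * G 0
  (F ⊠ G) (suc n) = (D F ⊠ G) n + (F ⊠ D G) n

  const : Carrier → Series
  const x zero    = x
  const x (suc _) = 0#

  X : Series
  X zero    = 0#
  X (suc n) = const 1# n

  ⊠-cong : ∀ {F F′ G G′} → F ≋ F′ → G ≋ G′ → F ⊠ G ≋ F′ ⊠ G′
  ⊠-cong e f zero    = *-cong (e 0) (f 0)
  ⊠-cong e f (suc n) =
    +-cong (⊠-cong (λ k → e (suc k)) f n) (⊠-cong e (λ k → f (suc k)) n)

  ⊠-comm : ∀ F G → F ⊠ G ≋ G ⊠ F
  ⊠-comm F G zero    = *-comm (F 0) (G 0)
  ⊠-comm F G (suc n) =
    trans (+-cong (⊠-comm (D F) G n) (⊠-comm F (D G) n)) (+-comm _ _)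

  ⊠-distribʳ : ∀ F G H → (G ⊕ H) ⊠ F ≋ G ⊠ F ⊕ H ⊠ F
  ⊠-distribʳ F G H zero    = distribʳ (F 0) (G 0) (H 0)
  ⊠-distribʳ F G H (suc n) = trans
    (+-cong (⊠-distribʳ F (D G) (D H) n) (⊠-distribʳ (D F) G H n))
    (solve 4 (λ a b c d → (a :+ b) :+ (c :+ d) := (a :+ c) :+ (b :+ d)) refl _ _ _ _)

  ⊠-distribˡ : ∀ F G H → F ⊠ (G ⊕ H) ≋ F ⊠ G ⊕ F ⊠ H
  ⊠-distribˡ F G H n = trans (⊠-comm F (G ⊕ H) n)
    (trans (⊠-distribʳ F G H n) (+-cong (⊠-comm G F n) (⊠-comm H F n)))

  ⊠-assoc : ∀ F G H → (F ⊠ G) ⊠ H ≋ F ⊠ (G ⊠ H)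
  ⊠-assoc F G H zero    = *-assoc (F 0) (G 0) (H 0)
  ⊠-assoc F G H (suc n) = begin
    ((D F ⊠ G ⊕ F ⊠ D G) ⊠ H) n + ((F ⊠ G) ⊠ D H) n
      ≈⟨ +-congʳ (⊠-distribʳ H (D F ⊠ G) (F ⊠ D G) n) ⟩
    (((D F ⊠ G) ⊠ H) n + ((F ⊠ D G) ⊠ H) n) + ((F ⊠ G) ⊠ D H) n
      ≈⟨ +-cong (+-cong (⊠-assoc (D F) G H n) (⊠-assoc F (D G) H n)) (⊠-assoc F G (D H) n) ⟩
    ((D F ⊠ (G ⊠ H)) n + (F ⊠ (D G ⊠ H)) n) + (F ⊠ (G ⊠ D H)) n
      ≈⟨ +-assoc _ _ _ ⟩
    (D F ⊠ (G ⊠ H)) n + ((F ⊠ (D G ⊠ H)) n + (F ⊠ (G ⊠ D H)) n)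
      ≈⟨ +-congˡ (⊠-distribˡ F (D G ⊠ H) (G ⊠ D H) n) ⟨
    (D F ⊠ (G ⊠ H)) n + (F ⊠ (D G ⊠ H ⊕ G ⊠ D H)) n ∎

  ⊠-zeroˡ : ∀ F → (λ _ → 0#) ⊠ F ≋ (λ _ → 0#)
  ⊠-zeroˡ F zero    = zeroˡ (F 0)
  ⊠-zeroˡ F (suc n) =
    trans (+-cong (⊠-zeroˡ F n) (⊠-zeroˡ (D F) n)) (+-identityˡ 0#)

  const-⊠ : ∀ x F n → (const x ⊠ F) n ≈ x * F n
  const-⊠ x F zero    = refl
  const-⊠ x F (suc n) =
    trans (+-cong (⊠-zeroˡ F n) (const-⊠ x (D F) n)) (+-identityˡ _)

  ⊠-identityˡ : ∀ F → const 1# ⊠ F ≋ F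
  ⊠-identityˡ F n = trans (const-⊠ 1# F n) (*-identityˡ (F n))

  seriesRing : CommutativeRing c ℓ
  seriesRing = record
    { Carrier = Series ; _≈_ = _≋_ ; _+_ = _⊕_ ; _*_ = _⊠_ ; -_ = λ F n → - F n
    ; 0# = λ _ → 0# ; 1# = const 1#
    ; isCommutativeRing = record
      { isRing = record
        { +-isAbelianGroup = record
          { isGroup = record
            { isMonoid = record
              { isSemigroup = record
                { isMagma = record
                  { isEquivalence = record
                    { refl  = λ _ → refl
                    ; sym   = λ e n → sym (e n)
                    ; trans = λ e f n → trans (e n) (f n)
                    }
                  ; ∙-cong = λ e f n → +-cong (e n) (f n)
                  }
                ; assoc = λ F G H n → +-assoc (F n) (G n) (H n)
                }
              ; identity = (λ F n → +-identityˡ (F n)) , (λ F n → +-identityʳ (F n))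
              }
            ; inverse = (λ F n → -‿inverseˡ (F n)) , (λ F n → -‿inverseʳ (F n))
            ; ⁻¹-cong = λ e n → -‿cong (e n)
            }
          ; comm = λ F G n → +-comm (F n) (G n)
          }
        ; *-cong = ⊠-cong
        ; *-assoc = ⊠-assoc
        ; *-identity = ⊠-identityˡ
                     , (λ F n → trans (⊠-comm F (const 1#) n) (⊠-identityˡ F n))
        ; distrib = ⊠-distribˡ , ⊠-distribʳ
        }
      ; *-comm = ⊠-comm
      }
    }

  X-⊠-zero : ∀ F → (X ⊠ F) 0 ≈ 0#
  X-⊠-zero F = zeroˡ (F 0)

  X-⊠-suc : ∀ F n → (X ⊠ F) (suc n) ≈ suc n × F n
  X-⊠-suc F zero    = +-cong (*-identityˡ (F 0)) (zeroˡ (F 1))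
  X-⊠-suc F (suc n) =
    +-cong (⊠-identityˡ F (suc n)) (X-⊠-suc (D F) n)

  -- Multiplication by `X` shifts a series and scales its coefficients by `suc n`, so this condition
  -- makes it injective. It is assumed of the coefficients alone; in two variables it is applied to
  -- one coefficient at a time.
  TorsionFree : Set _
  TorsionFree = ∀ n {x y} → suc n × x ≈ suc n × y → x ≈ y

-- Exponential series, the substitution t ↦ -t and the reflection of Bernoulli series.

module Exponentials {c ℓ} (R : CommutativeRing c ℓ) where
  open CommutativeRing R hiding (zero)
  open Algebra.Properties.Semiring.Exp semiring using (_^_; ^-congˡ)
  open Algebra.Properties.Ring ring
    using (-‿distribˡ-*; -‿+-comm; -0#≈0#; -1*x≈-x)
  open Hurwitz R
  private
    module S = CommutativeRing seriesRing
    module SP = Algebra.Properties.Ring S.ring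

  -- e^{xt}
  E : Carrier → Series
  E x n = x ^ n

  -- e^t - 1
  E-1 : Series
  E-1 zero    = 0#
  E-1 (suc _) = 1#

  -- (e^t - 1) F(t) = t e^{xt}
  IsBernoulli : Carrier → Series → Set ℓ
  IsBernoulli x F = E-1 ⊠ F ≋ X ⊠ E x

  E-cong : ∀ {x y} → x ≈ y → E x ≋ E y
  E-cong e n = ^-congˡ n e

  scale-⊠ : ∀ x F G n → ((λ k → x * F k) ⊠ G) n ≈ x * (F ⊠ G) n
  scale-⊠ x F G zero    = *-assoc x (F 0) (G 0)
  scale-⊠ x F G (suc n) =
    trans (+-cong (scale-⊠ x (D F) G n) (scale-⊠ x F (D G) n)) (sym (distribˡ x _ _))

  -- `D (E x)` is by definition `x` times `E x`, so the Leibniz rule shows that the product solves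
  -- the same equation D F = (x + y) F as the right side, with the same constant term 1.
  E-+ : ∀ x y → E x ⊠ E y ≋ E (x + y)
  E-+ x y zero    = *-identityˡ 1#
  E-+ x y (suc n) = begin
    (D (E x) ⊠ E y) n + (E x ⊠ D (E y)) n
      ≈⟨ +-cong (scale-⊠ x (E x) (E y) n)
           (trans (⊠-comm (E x) _ n) (scale-⊠ y (E y) (E x) n)) ⟩
    x * (E x ⊠ E y) n + y * (E y ⊠ E x) n
      ≈⟨ +-cong (*-congˡ (E-+ x y n)) (*-congˡ (trans (⊠-comm (E y) (E x) n) (E-+ x y n))) ⟩
    x * E (x + y) n + y * E (x + y) n
      ≈⟨ distribʳ _ x y ⟨
    (x + y) * E (x + y) n ∎
    where open Relation.Binary.Reasoning.Setoid setoid

  E-1≋E : const 1# ⊕ E-1 ≋ E 1#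
  E-1≋E zero    = +-identityʳ 1#
  E-1≋E (suc n) = trans (+-identityˡ 1#) (sym (1^ (suc n)))
    where
    1^ : ∀ n → 1# ^ n ≈ 1#
    1^ zero    = refl
    1^ (suc n) = trans (*-identityˡ _) (1^ n)

  E-0 : E 0# ≋ const 1#
  E-0 zero    = refl
  E-0 (suc n) = zeroˡ _

  -- F(t) ↦ F(-t)
  τ : Series → Series
  τ F n = (- 1#) ^ n * F n

  -- The chain rule for t ↦ -t, through which multiplicativity of `τ` reduces to the Leibniz
  -- recursion.
  D-τ : ∀ F → D (τ F) ≋ S.- τ (D F)
  D-τ F n = trans (*-assoc _ _ _) (-1*x≈-x _)

  neg-⊠ : ∀ F G → (S.- F) ⊠ G ≋ S.- (F ⊠ G)
  neg-⊠ F G = S.sym {S.- (F ⊠ G)} {(S.- F) ⊠ G} (SP.-‿distribˡ-* F G)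

  τ-⊠ : ∀ F G → τ (F ⊠ G) ≋ τ F ⊠ τ G
  τ-⊠ F G zero    = trans (*-identityˡ _)
    (sym (*-cong (*-identityˡ _) (*-identityˡ _)))
  τ-⊠ F G (suc n) = begin
    τ (F ⊠ G) (suc n)                          ≈⟨ D-τ (F ⊠ G) n ⟩
    - τ (D F ⊠ G ⊕ F ⊠ D G) n                  ≈⟨ -‿cong (distribˡ _ _ _) ⟩
    - (τ (D F ⊠ G) n + τ (F ⊠ D G) n)          ≈⟨ -‿+-comm _ _ ⟨
    - τ (D F ⊠ G) n + - τ (F ⊠ D G) n
      ≈⟨ +-cong (-‿cong (τ-⊠ (D F) G n)) (-‿cong (τ-⊠ F (D G) n)) ⟩
    - (τ (D F) ⊠ τ G) n + - (τ F ⊠ τ (D G)) n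
      ≈⟨ +-cong (neg-⊠ (τ (D F)) (τ G) n) (sym (SP.-‿distribʳ-* (τ F) (τ (D G)) n)) ⟨
    ((S.- τ (D F)) ⊠ τ G) n + (τ F ⊠ (S.- τ (D G))) n
      ≈⟨ +-cong (⊠-cong (D-τ F) (λ _ → refl) n) (⊠-cong (λ _ → refl) (D-τ G) n) ⟨
    (D (τ F) ⊠ τ G) n + (τ F ⊠ D (τ G)) n      ∎
    where open Relation.Binary.Reasoning.Setoid setoid

  τ-E : ∀ x → τ (E x) ≋ E (- x)
  τ-E x zero    = *-identityˡ 1#
  τ-E x (suc n) = begin
    τ (E x) (suc n)                 ≈⟨ D-τ (E x) n ⟩
    - ((- 1#) ^ n * (x * x ^ n))    ≈⟨ -‿cong (x∙yz≈y∙xz _ _ _) ⟩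
    - (x * ((- 1#) ^ n * x ^ n))    ≈⟨ -‿distribˡ-* _ _ ⟩
    - x * ((- 1#) ^ n * x ^ n)      ≈⟨ *-congˡ (τ-E x n) ⟩
    - x * (- x) ^ n                 ∎
    where
    open Relation.Binary.Reasoning.Setoid setoid
    open Algebra.Properties.CommutativeSemigroup *-commutativeSemigroup
      using (x∙yz≈y∙xz)

  τ-const1 : τ (const 1#) ≋ const 1#
  τ-const1 zero    = *-identityˡ 1#
  τ-const1 (suc n) = zeroʳ _

  τ-X : τ X ≋ S.- X
  τ-X zero    = trans (*-identityˡ 0#) (sym -0#≈0#)
  τ-X (suc n) = trans (D-τ X n) (-‿cong (τ-const1 n))

  reflect : ∀ {x F} → IsBernoulli x F → IsBernoulli (1# - x) (τ F)
  reflect {x} {F} isB = S.trans {E-1 ⊠ τ F} {S.- (S.- (E-1 ⊠ τ F))}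
      (S.sym {S.- (S.- (E-1 ⊠ τ F))} {E-1 ⊠ τ F} (SP.-‿involutive (E-1 ⊠ τ F))) (begin
    S.- (S.- (E-1 ⊠ τ F))      ≈⟨ S.-‿cong (neg-⊠ E-1 (τ F)) ⟨
    S.- ((S.- E-1) ⊠ τ F)      ≈⟨ S.-‿cong (⊠-cong E-1-neg (λ _ → refl)) ⟨
    S.- ((E 1# ⊠ τ E-1) ⊠ τ F) ≈⟨ S.-‿cong (⊠-assoc (E 1#) (τ E-1) (τ F)) ⟩
    S.- (E 1# ⊠ (τ E-1 ⊠ τ F)) ≈⟨ S.-‿cong (S.*-congˡ {E 1#} τ-isB) ⟩
    S.- (E 1# ⊠ (S.- (X ⊠ E (- x)))) ≈⟨ S.-‿cong (SP.-‿distribʳ-* (E 1#) (X ⊠ E (- x))) ⟨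
    S.- (S.- (E 1# ⊠ (X ⊠ E (- x)))) ≈⟨ SP.-‿involutive _ ⟩
    E 1# ⊠ (X ⊠ E (- x))       ≈⟨ x∙yz≈y∙xz (E 1#) X (E (- x)) ⟩
    X ⊠ (E 1# ⊠ E (- x))       ≈⟨ S.*-congˡ {X} (E-+ 1# (- x)) ⟩
    X ⊠ E (1# - x)             ∎)
    where
    open Relation.Binary.Reasoning.Setoid S.setoid
    open Algebra.Properties.CommutativeSemigroup S.*-commutativeSemigroup
      using (x∙yz≈y∙xz)
    τ-isB : τ E-1 ⊠ τ F ≋ S.- (X ⊠ E (- x))
    τ-isB = begin
      τ E-1 ⊠ τ F          ≈⟨ τ-⊠ E-1 F ⟨
      τ (E-1 ⊠ F)          ≈⟨ (λ n → *-congˡ (isB n)) ⟩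
      τ (X ⊠ E x)          ≈⟨ τ-⊠ X (E x) ⟩
      τ X ⊠ τ (E x)        ≈⟨ ⊠-cong τ-X (τ-E x) ⟩
      (S.- X) ⊠ E (- x)    ≈⟨ neg-⊠ X (E (- x)) ⟩
      S.- (X ⊠ E (- x))    ∎
    τ-E-1 : const 1# ⊕ τ E-1 ≋ E (- 1#)
    τ-E-1 = begin
      const 1# ⊕ τ E-1       ≈⟨ S.+-congʳ {τ E-1} τ-const1 ⟨
      τ (const 1#) ⊕ τ E-1   ≈⟨ (λ n → distribˡ _ _ _) ⟨
      τ (const 1# ⊕ E-1)     ≈⟨ (λ n → *-congˡ (E-1≋E n)) ⟩
      τ (E 1#)               ≈⟨ τ-E 1# ⟩
      E (- 1#)               ∎
    E-1-neg : E 1# ⊠ τ E-1 ≋ S.- E-1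
    E-1-neg = SP.+-cancelˡ (E 1#) _ _ (begin
      E 1# ⊕ E 1# ⊠ τ E-1             ≈⟨ S.+-congʳ {E 1# ⊠ τ E-1} (S.*-identityʳ (E 1#)) ⟨
      E 1# ⊠ const 1# ⊕ E 1# ⊠ τ E-1  ≈⟨ ⊠-distribˡ (E 1#) (const 1#) (τ E-1) ⟨
      E 1# ⊠ (const 1# ⊕ τ E-1)       ≈⟨ S.*-congˡ {E 1#} τ-E-1 ⟩
      E 1# ⊠ E (- 1#)                 ≈⟨ E-+ 1# (- 1#) ⟩
      E (1# - 1#)                     ≈⟨ E-cong (-‿inverseʳ 1#) ⟩
      E 0#                            ≈⟨ E-0 ⟩
      const 1#                        ≈⟨ S.+-identityʳ (const 1#) ⟨
      const 1# ⊕ S.0#                 ≈⟨ S.+-congˡ {const 1#} (S.-‿inverseʳ E-1) ⟨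
      const 1# ⊕ (E-1 S.- E-1)        ≈⟨ S.+-assoc (const 1#) E-1 (S.- E-1) ⟨
      (const 1# ⊕ E-1) S.- E-1        ≈⟨ S.+-congʳ {S.- E-1} E-1≋E ⟩
      E 1# ⊕ (S.- E-1)                ∎)

-- The identity between exponentials and the removal of denominators, over any commutative ring.

module RingIdentities {c ℓ} (R : CommutativeRing c ℓ) where
  open CommutativeRing R
  open Algebra.Properties.Ring ring using (+-cancelˡ)
  open Algebra.Solver.Ring.NaturalCoefficients.Default commutativeSemiring
    using (solve; _:=_; _:+_; _:*_; con)
  open Relation.Binary.Reasoning.Setoid setoid

  private
    -- Eliminates `c` without a subtraction, so that what remains are identities of commutative
    -- semirings, within reach of the solver with natural coefficients.
    expand : ∀ {a b c} → 1# + c ≈ (1# + a) * (1# + b) → c ≈ a + b + a * b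
    expand {a} {b} {c} e = +-cancelˡ 1# _ _ (trans e
      (solve 2 (λ a b → (con 1 :+ a) :* (con 1 :+ b) := con 1 :+ (a :+ b :+ a :* b)) refl a b))

  -- With a = e^s - 1, b = e^t - 1, c = e^{s+t} - 1, the identities
  -- e^{zs+yt}(e^{s+t} - 1) = e^{ys+yt+xs}(e^t - 1) + e^{zs+zt+(1-x)t}(e^s - 1)
  -- for z = x + y and for z = x + y - 1.
  numerators₁ : ∀ {a b c ez ey eyt ex ezt f} → 1# + c ≈ (1# + a) * (1# + b) →
    ey * ex ≈ ez → ezt * f ≈ eyt * (1# + b) →
    c * (ez * eyt) ≈ b * ((ey * eyt) * ex) + a * ((ez * ezt) * f)
  numerators₁ {a} {b} {c} {ez} {ey} {eyt} {ex} {ezt} {f} ec e₁ e₂ = begin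
    c * (ez * eyt)
      ≈⟨ *-congʳ (expand ec) ⟩
    (a + b + a * b) * (ez * eyt)
      ≈⟨ solve 4 (λ a b u v → (a :+ b :+ a :* b) :* (u :* v)
           := b :* (u :* v) :+ a :* (u :* (v :* (con 1 :+ b)))) refl a b ez eyt ⟩
    b * (ez * eyt) + a * (ez * (eyt * (1# + b)))
      ≈⟨ +-cong (*-congˡ (*-congʳ e₁)) (*-congˡ (*-congˡ e₂)) ⟨
    b * ((ey * ex) * eyt) + a * (ez * (ezt * f))
      ≈⟨ solve 8 (λ a b ey ex eyt ez ezt f →
           b :* ((ey :* ex) :* eyt) :+ a :* (ez :* (ezt :* f))
           := b :* ((ey :* eyt) :* ex) :+ a :* ((ez :* ezt) :* f)) refl a b ey ex eyt ez ezt f ⟩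
    b * ((ey * eyt) * ex) + a * ((ez * ezt) * f) ∎

  numerators₂ : ∀ {a b c ez ey eyt ex ezt f} → 1# + c ≈ (1# + a) * (1# + b) →
    ey * ex ≈ ez * (1# + a) → ezt * f ≈ eyt →
    c * (ez * eyt) ≈ b * ((ey * eyt) * ex) + a * ((ez * ezt) * f)
  numerators₂ {a} {b} {c} {ez} {ey} {eyt} {ex} {ezt} {f} ec e₁ e₂ = begin
    c * (ez * eyt)
      ≈⟨ *-congʳ (expand ec) ⟩
    (a + b + a * b) * (ez * eyt)
      ≈⟨ solve 4 (λ a b u v → (a :+ b :+ a :* b) :* (u :* v)
           := b :* ((u :* (con 1 :+ a)) :* v) :+ a :* (u :* v)) refl a b ez eyt ⟩
    b * ((ez * (1# + a)) * eyt) + a * (ez * eyt)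
      ≈⟨ +-cong (*-congˡ (*-congʳ e₁)) (*-congˡ (*-congˡ e₂)) ⟨
    b * ((ey * ex) * eyt) + a * (ez * (ezt * f))
      ≈⟨ solve 8 (λ a b ey ex eyt ez ezt f →
           b :* ((ey :* ex) :* eyt) :+ a :* (ez :* (ezt :* f))
           := b :* ((ey :* eyt) :* ex) :+ a :* ((ez :* ezt) :* f)) refl a b ey ex eyt ez ezt f ⟩
    b * ((ey * eyt) * ex) + a * ((ez * ezt) * f) ∎

  -- Multiplying by a, b, c clears the denominators; multiplying by the Bernoulli series
  -- α, β, γ at 0 then turns a, b, c into s, t, w = s + t, which can be cancelled.
  clear-denominators : ∀ {s t w a b c α β γ Gz Gy Hy Hz Gx Gx⁻ ez ey Ey Ez ex f} →
    a * α ≈ s → b * β ≈ t → c * γ ≈ w →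
    a * Gz ≈ s * ez → b * Gy ≈ t * ey → c * Hy ≈ w * Ey → c * Hz ≈ w * Ez →
    a * Gx ≈ s * ex → b * Gx⁻ ≈ t * f →
    c * (ez * ey) ≈ b * (Ey * ex) + a * (Ez * f) →
    s * (t * (w * (w * (Gz * Gy)))) ≈ s * (t * (w * (t * (Hy * Gx) + s * (Hz * Gx⁻))))
  clear-denominators {s} {t} {w} {a} {b} {c} {α} {β} {γ} {Gz} {Gy} {Hy} {Hz} {Gx} {Gx⁻} {ez} {ey} {Ey} {Ez} {ex} {f}
      hs ht hw hGz hGy hHy hHz hGx hGx⁻ key = begin
    s * (t * (w * (w * (Gz * Gy))))
      ≈⟨ *-cong hs (*-cong ht (*-congʳ hw)) ⟨
    (a * α) * ((b * β) * ((c * γ) * (w * (Gz * Gy))))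
      ≈⟨ solve 9 (λ a α b β c γ w Gz Gy →
           (a :* α) :* ((b :* β) :* ((c :* γ) :* (w :* (Gz :* Gy))))
           := (α :* β :* γ) :* (w :* (c :* ((a :* Gz) :* (b :* Gy)))))
           refl a α b β c γ w Gz Gy ⟩
    (α * β * γ) * (w * (c * ((a * Gz) * (b * Gy))))
      ≈⟨ *-congˡ (*-congˡ (*-congˡ (*-cong hGz hGy))) ⟩
    (α * β * γ) * (w * (c * ((s * ez) * (t * ey))))
      ≈⟨ solve 7 (λ k w c s ez t ey → k :* (w :* (c :* ((s :* ez) :* (t :* ey))))
           := (k :* w :* s :* t) :* (c :* (ez :* ey))) refl (α * β * γ) w c s ez t ey ⟩
    (α * β * γ * w * s * t) * (c * (ez * ey))
      ≈⟨ *-congˡ key ⟩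
    (α * β * γ * w * s * t) * (b * (Ey * ex) + a * (Ez * f))
      ≈⟨ solve 10 (λ k w s t b Ey ex a Ez f →
           (k :* w :* s :* t) :* (b :* (Ey :* ex) :+ a :* (Ez :* f))
           := k :* (t :* (b :* ((w :* Ey) :* (s :* ex))) :+ s :* (a :* ((w :* Ez) :* (t :* f)))))
           refl (α * β * γ) w s t b Ey ex a Ez f ⟩
    (α * β * γ) * (t * (b * ((w * Ey) * (s * ex))) + s * (a * ((w * Ez) * (t * f))))
      ≈⟨ *-congˡ (+-cong (*-congˡ (*-congˡ (*-cong hHy hGx)))
                         (*-congˡ (*-congˡ (*-cong hHz hGx⁻)))) ⟨
    (α * β * γ) * (t * (b * ((c * Hy) * (a * Gx))) + s * (a * ((c * Hz) * (b * Gx⁻))))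
      ≈⟨ solve 12 (λ α β γ s t a b c Hy Gx Hz Gx⁻ →
           (α :* β :* γ) :* (t :* (b :* ((c :* Hy) :* (a :* Gx))) :+ s :* (a :* ((c :* Hz) :* (b :* Gx⁻))))
           := (a :* α) :* ((b :* β) :* ((c :* γ) :* (t :* (Hy :* Gx) :+ s :* (Hz :* Gx⁻)))))
           refl α β γ s t a b c Hy Gx Hz Gx⁻ ⟩
    (a * α) * ((b * β) * ((c * γ) * (t * (Hy * Gx) + s * (Hz * Gx⁻))))
      ≈⟨ *-cong hs (*-cong ht (*-congʳ hw)) ⟩
    s * (t * (w * (t * (Hy * Gx) + s * (Hz * Gx⁻)))) ∎

-- Series in two variables and the generating function identity.

-- Series in s (outer) and t (inner).
module Bivariate {c ℓ} (R : CommutativeRing c ℓ) where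
  open CommutativeRing R hiding (zero)
  open Algebra.Properties.Ring ring using (+-cancelʳ)
  open Algebra.Properties.Semiring.Mult semiring using (_×_; ×-congʳ)
  open Algebra.Properties.Semiring.Exp semiring using (^-homo-*)
  open Hurwitz R
  open Exponentials R
  private
    module S = CommutativeRing seriesRing
    module SM = Algebra.Properties.Semiring.Mult S.semiring
    module H₂ = Hurwitz seriesRing
    module K = CommutativeRing H₂.seriesRing
    open RingIdentities H₂.seriesRing

  Series₂ : Set _
  Series₂ = K.Carrier

  infix 4 _≋₂_
  _≋₂_ : Series₂ → Series₂ → Set ℓ
  _≋₂_ = K._≈_

  infixl 7 _⊠₂_
  _⊠₂_ : Series₂ → Series₂ → Series₂
  _⊠₂_ = K._*_

  infixl 6 _⊕₂_
  _⊕₂_ : Series₂ → Series₂ → Series₂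
  _⊕₂_ = K._+_

  -- F(s), F(t) and F(s + t); in exponential coefficients the last is Taylor's formula.
  in-s in-t in-s+t : Series → Series₂
  in-s F m = const (F m)
  in-t F = H₂.const F
  in-s+t F m n = F (m +ℕ n)

  s t : Series₂
  s = H₂.X
  t = in-t X

  const-cong : ∀ {x y} → x ≈ y → const x ≋ const y
  const-cong e zero    = e
  const-cong e (suc n) = refl

  const-+ : ∀ x y → const (x + y) ≋ const x ⊕ const y
  const-+ x y zero    = refl
  const-+ x y (suc n) = sym (+-identityˡ 0#)

  const-* : ∀ x y → const (x * y) ≋ const x ⊠ const y
  const-* x y zero    = refl
  const-* x y (suc n) = sym (trans (const-⊠ x (const y) (suc n)) (zeroʳ x))

  in-s-cong : ∀ {F G} → F ≋ G → in-s F ≋₂ in-s G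
  in-s-cong e m = const-cong (e m)

  in-t-cong : ∀ {F G} → F ≋ G → in-t F ≋₂ in-t G
  in-t-cong e zero    n = e n
  in-t-cong e (suc m) n = refl

  in-s+t-cong : ∀ {F G} → F ≋ G → in-s+t F ≋₂ in-s+t G
  in-s+t-cong e m n = e (m +ℕ n)

  in-s-⊠ : ∀ F G → in-s (F ⊠ G) ≋₂ in-s F ⊠₂ in-s G
  in-s-⊠ F G zero    = const-* (F 0) (G 0)
  in-s-⊠ F G (suc m) n = trans (const-+ ((D F ⊠ G) m) ((F ⊠ D G) m) n)
    (+-cong (in-s-⊠ (D F) G m n) (in-s-⊠ F (D G) m n))

  in-t-⊠ : ∀ F G → in-t (F ⊠ G) ≋₂ in-t F ⊠₂ in-t G
  in-t-⊠ F G zero    n = refl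
  in-t-⊠ F G (suc m) n =
    sym (trans (H₂.const-⊠ F (H₂.const G) (suc m) n) (S.zeroʳ F n))

  -- The substitution commutes with the derivative in s and is the identity at s = 0, so the Leibniz
  -- recursion in the outer variable gives multiplicativity.
  in-s+t-⊠ : ∀ F G → in-s+t (F ⊠ G) ≋₂ in-s+t F ⊠₂ in-s+t G
  in-s+t-⊠ F G zero    n = refl
  in-s+t-⊠ F G (suc m) n = +-cong (in-s+t-⊠ (D F) G m n) (in-s+t-⊠ F (D G) m n)

  in-s-⊕ : ∀ F G → in-s (F ⊕ G) ≋₂ in-s F ⊕₂ in-s G
  in-s-⊕ F G m = const-+ (F m) (G m)

  in-t-⊕ : ∀ F G → in-t (F ⊕ G) ≋₂ in-t F ⊕₂ in-t G
  in-t-⊕ F G zero    n = refl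
  in-t-⊕ F G (suc m) n = sym (+-identityˡ 0#)

  const-0 : const 0# ≋ S.0#
  const-0 zero    = refl
  const-0 (suc n) = refl

  in-s-1 : in-s (const 1#) ≋₂ K.1#
  in-s-1 zero    n = refl
  in-s-1 (suc m) n = const-0 n

  in-s+t-1 : in-s+t (const 1#) ≋₂ K.1#
  in-s+t-1 zero    n = refl
  in-s+t-1 (suc m) n = refl

  in-s-X : in-s X ≋₂ s
  in-s-X zero    n = const-0 n
  in-s-X (suc m) n = in-s-1 m n

  in-s+t-X : in-s+t X ≋₂ s ⊕₂ t
  in-s+t-X zero    n = sym (+-identityˡ _)
  in-s+t-X (suc m) n = trans (in-s+t-1 m n) (sym (+-identityʳ _))

  ⊠-in-s : ∀ F g m n → (F ⊠₂ in-s g) m n ≈ ((λ k → F k n) ⊠ g) m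
  ⊠-in-s F g zero    n = trans (⊠-comm (F 0) _ n)
    (trans (const-⊠ (g 0) (F 0) n) (*-comm _ _))
  ⊠-in-s F g (suc m) n =
    +-cong (⊠-in-s (H₂.D F) g m n) (⊠-in-s F (D g) m n)

  ⊠-in-t : ∀ F g m n → (F ⊠₂ in-t g) m n ≈ (F m ⊠ g) n
  ⊠-in-t F g m n = trans (K.*-comm F (in-t g) m n)
    (trans (H₂.const-⊠ g F m n) (⊠-comm g (F m) n))

  in-s-⊠-in-t : ∀ f g m n → (in-s f ⊠₂ in-t g) m n ≈ f m * g n
  in-s-⊠-in-t f g m n = trans (⊠-in-t (in-s f) g m n) (const-⊠ (f m) g n)

  in-s+t-E : ∀ x → in-s+t (E x) ≋₂ in-s (E x) ⊠₂ in-t (E x)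
  in-s+t-E x m n = trans (^-homo-* x m n) (sym (in-s-⊠-in-t (E x) (E x) m n))

  ×-at : ∀ n F k → (n SM.× F) k ≈ n × F k
  ×-at zero    F k = refl
  ×-at (suc n) F k = +-congˡ (×-at n F k)

  s-⊠-suc : ∀ F m n → (s ⊠₂ F) (suc m) n ≈ suc m × F m n
  s-⊠-suc F m n = trans (H₂.X-⊠-suc F m n) (×-at (suc m) (F m) n)

  t-⊠ : ∀ F m n → (t ⊠₂ F) m n ≈ (X ⊠ F m) n
  t-⊠ F m n = H₂.const-⊠ X F m n

  t-⊠-suc : ∀ F m n → (t ⊠₂ F) m (suc n) ≈ suc n × F m n
  t-⊠-suc F m n = trans (t-⊠ F m (suc n)) (X-⊠-suc (F m) n)

  s+t-⊠-zero : ∀ F m → ((s ⊕₂ t) ⊠₂ F) (suc m) 0 ≈ suc m × F m 0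
  s+t-⊠-zero F m = trans (H₂.⊠-distribʳ F s t (suc m) 0)
    (trans (+-cong (s-⊠-suc F m 0) (trans (t-⊠ F (suc m) 0) (X-⊠-zero (F (suc m)))))
           (+-identityʳ _))

  s+t-⊠-suc : ∀ F m n → ((s ⊕₂ t) ⊠₂ F) (suc m) (suc n)
              ≈ suc m × F m (suc n) + suc n × F (suc m) n
  s+t-⊠-suc F m n = trans (H₂.⊠-distribʳ F s t (suc m) (suc n))
    (+-cong (s-⊠-suc F m (suc n)) (t-⊠-suc F (suc m) n))

  module _ (torsionFree : TorsionFree) where

    s-cancel : ∀ {F G} → s ⊠₂ F ≋₂ s ⊠₂ G → F ≋₂ G
    s-cancel {F} {G} e m n = torsionFree m
      (trans (sym (s-⊠-suc F m n)) (trans (e (suc m) n) (s-⊠-suc G m n)))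

    t-cancel : ∀ {F G} → t ⊠₂ F ≋₂ t ⊠₂ G → F ≋₂ G
    t-cancel {F} {G} e m n = torsionFree n
      (trans (sym (t-⊠-suc F m n)) (trans (e m (suc n)) (t-⊠-suc G m n)))

    -- Induction on the degree in t. In t-degree 0 only s contributes to (s + t) F. The coefficient
    -- at `(suc m, suc n)` combines `F m (suc n)` with `F (suc m) n`, and the latter is already
    -- known from the smaller t-degree; this is why all `m` are treated at once.
    s+t-cancel : ∀ {F G} → (s ⊕₂ t) ⊠₂ F ≋₂ (s ⊕₂ t) ⊠₂ G → F ≋₂ G
    s+t-cancel {F} {G} e m zero = torsionFree m
      (trans (sym (s+t-⊠-zero F m)) (trans (e (suc m) 0) (s+t-⊠-zero G m)))
    s+t-cancel {F} {G} e m (suc n) = torsionFree m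
      (+-cancelʳ (suc n × G (suc m) n) _ _
        (trans (+-congˡ (×-congʳ (suc n) (sym (s+t-cancel {F} {G} e (suc m) n))))
          (trans (sym (s+t-⊠-suc F m n))
            (trans (e (suc m) (suc n)) (s+t-⊠-suc G m n)))))

    module _ {x y z : Carrier} {Bx By Bz B₀ : Series}
      (isBx : IsBernoulli x Bx) (isBy : IsBernoulli y By)
      (isBz : IsBernoulli z Bz) (isB₀ : IsBernoulli 0# B₀)
      (z≈x+y⊎z+1≈x+y : z ≈ x + y ⊎ z + 1# ≈ x + y) where

      private
        a b c₂ : Series₂
        a  = in-s E-1
        b  = in-t E-1
        c₂ = in-s+t E-1

        from-s : ∀ {u F} → IsBernoulli u F → a ⊠₂ in-s F ≋₂ s ⊠₂ in-s (E u)
        from-s {u} {F} isF = begin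
          a ⊠₂ in-s F             ≈⟨ in-s-⊠ E-1 F ⟨
          in-s (E-1 ⊠ F)          ≈⟨ in-s-cong isF ⟩
          in-s (X ⊠ E u)          ≈⟨ in-s-⊠ X (E u) ⟩
          in-s X ⊠₂ in-s (E u)    ≈⟨ K.*-congʳ {in-s (E u)} in-s-X ⟩
          s ⊠₂ in-s (E u)         ∎
          where open Relation.Binary.Reasoning.Setoid K.setoid

        from-t : ∀ {u F} → IsBernoulli u F → b ⊠₂ in-t F ≋₂ t ⊠₂ in-t (E u)
        from-t {u} {F} isF = begin
          b ⊠₂ in-t F             ≈⟨ in-t-⊠ E-1 F ⟨
          in-t (E-1 ⊠ F)          ≈⟨ in-t-cong isF ⟩
          in-t (X ⊠ E u)          ≈⟨ in-t-⊠ X (E u) ⟩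
          t ⊠₂ in-t (E u)         ∎
          where open Relation.Binary.Reasoning.Setoid K.setoid

        from-s+t : ∀ {u F} → IsBernoulli u F →
          c₂ ⊠₂ in-s+t F ≋₂ (s ⊕₂ t) ⊠₂ (in-s (E u) ⊠₂ in-t (E u))
        from-s+t {u} {F} isF = begin
          c₂ ⊠₂ in-s+t F            ≈⟨ in-s+t-⊠ E-1 F ⟨
          in-s+t (E-1 ⊠ F)          ≈⟨ in-s+t-cong isF ⟩
          in-s+t (X ⊠ E u)          ≈⟨ in-s+t-⊠ X (E u) ⟩
          in-s+t X ⊠₂ in-s+t (E u)  ≈⟨ H₂.⊠-cong in-s+t-X (in-s+t-E u) ⟩
          (s ⊕₂ t) ⊠₂ (in-s (E u) ⊠₂ in-t (E u)) ∎
          where open Relation.Binary.Reasoning.Setoid K.setoid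

        isB₀′ : E-1 ⊠ B₀ ≋ X
        isB₀′ n = trans (isB₀ n) (trans (S.*-congˡ {X} E-0 n) (S.*-identityʳ X n))

        a-inv : a ⊠₂ in-s B₀ ≋₂ s
        a-inv = K.trans {a ⊠₂ in-s B₀} {in-s (E-1 ⊠ B₀)} {s}
          (K.sym {in-s (E-1 ⊠ B₀)} {a ⊠₂ in-s B₀} (in-s-⊠ E-1 B₀))
          (K.trans {in-s (E-1 ⊠ B₀)} {in-s X} {s} (in-s-cong isB₀′) in-s-X)

        b-inv : b ⊠₂ in-t B₀ ≋₂ t
        b-inv = K.trans {b ⊠₂ in-t B₀} {in-t (E-1 ⊠ B₀)} {t}
          (K.sym {in-t (E-1 ⊠ B₀)} {b ⊠₂ in-t B₀} (in-t-⊠ E-1 B₀)) (in-t-cong isB₀′)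

        c-inv : c₂ ⊠₂ in-s+t B₀ ≋₂ s ⊕₂ t
        c-inv = K.trans {c₂ ⊠₂ in-s+t B₀} {in-s+t (E-1 ⊠ B₀)} {s ⊕₂ t}
          (K.sym {in-s+t (E-1 ⊠ B₀)} {c₂ ⊠₂ in-s+t B₀} (in-s+t-⊠ E-1 B₀))
          (K.trans {in-s+t (E-1 ⊠ B₀)} {in-s+t X} {s ⊕₂ t} (in-s+t-cong isB₀′) in-s+t-X)

        1+a : K.1# ⊕₂ a ≋₂ in-s (E 1#)
        1+a = begin
          K.1# ⊕₂ a               ≈⟨ K.+-congʳ {a} in-s-1 ⟨
          in-s (const 1#) ⊕₂ a    ≈⟨ in-s-⊕ (const 1#) E-1 ⟨
          in-s (const 1# ⊕ E-1)   ≈⟨ in-s-cong E-1≋E ⟩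
          in-s (E 1#)             ∎
          where open Relation.Binary.Reasoning.Setoid K.setoid

        1+b : K.1# ⊕₂ b ≋₂ in-t (E 1#)
        1+b = begin
          K.1# ⊕₂ b               ≈⟨ in-t-⊕ (const 1#) E-1 ⟨
          in-t (const 1# ⊕ E-1)   ≈⟨ in-t-cong E-1≋E ⟩
          in-t (E 1#)             ∎
          where open Relation.Binary.Reasoning.Setoid K.setoid

        1+c : K.1# ⊕₂ c₂ ≋₂ (K.1# ⊕₂ a) ⊠₂ (K.1# ⊕₂ b)
        1+c = begin
          K.1# ⊕₂ c₂                    ≈⟨ K.+-congʳ {c₂} in-s+t-1 ⟨
          in-s+t (const 1# ⊕ E-1)       ≈⟨ in-s+t-cong E-1≋E ⟩
          in-s+t (E 1#)                 ≈⟨ in-s+t-E 1# ⟩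
          in-s (E 1#) ⊠₂ in-t (E 1#)    ≈⟨ H₂.⊠-cong 1+a 1+b ⟨
          (K.1# ⊕₂ a) ⊠₂ (K.1# ⊕₂ b)    ∎
          where open Relation.Binary.Reasoning.Setoid K.setoid

        s-E : ∀ u v {w} → u + v ≈ w → in-s (E u) ⊠₂ in-s (E v) ≋₂ in-s (E w)
        s-E u v {w} e = begin
          in-s (E u) ⊠₂ in-s (E v)  ≈⟨ in-s-⊠ (E u) (E v) ⟨
          in-s (E u ⊠ E v)          ≈⟨ in-s-cong (λ n → trans (E-+ u v n) (E-cong e n)) ⟩
          in-s (E w)                ∎
          where open Relation.Binary.Reasoning.Setoid K.setoid

        t-E : ∀ u v {w} → u + v ≈ w → in-t (E u) ⊠₂ in-t (E v) ≋₂ in-t (E w)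
        t-E u v {w} e = begin
          in-t (E u) ⊠₂ in-t (E v)  ≈⟨ in-t-⊠ (E u) (E v) ⟨
          in-t (E u ⊠ E v)          ≈⟨ in-t-cong (λ n → trans (E-+ u v n) (E-cong e n)) ⟩
          in-t (E w)                ∎
          where open Relation.Binary.Reasoning.Setoid K.setoid

        cancel-x : ∀ {u v} → u ≈ x + v → u - x ≈ v
        cancel-x {u} {v} e = trans (+-congʳ e) (trans (+-congʳ (+-comm x v))
          (trans (+-assoc v x (- x)) (trans (+-congˡ (-‿inverseʳ x)) (+-identityʳ v))))

        -- The exponent z + 1 - x is y + 1 in the first case and y in the second, whereas x + y is z
        -- or z + 1. One surplus exponential occurs either way: e^t in the first case, e^s in the
        -- second.
        numerators : z ≈ x + y ⊎ z + 1# ≈ x + y →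
          c₂ ⊠₂ (in-s (E z) ⊠₂ in-t (E y))
          ≋₂ b ⊠₂ ((in-s (E y) ⊠₂ in-t (E y)) ⊠₂ in-s (E x))
             ⊕₂ a ⊠₂ ((in-s (E z) ⊠₂ in-t (E z)) ⊠₂ in-t (E (1# - x)))
        numerators (inj₁ e) = numerators₁ {a} {b} {c₂} {in-s (E z)} {in-s (E y)} {in-t (E y)}
              {in-s (E x)} {in-t (E z)} {in-t (E (1# - x))} 1+c
              (s-E y x (trans (+-comm y x) (sym e)))
              (K.trans {in-t (E z) ⊠₂ in-t (E (1# - x))} {in-t (E (y + 1#))}
                {in-t (E y) ⊠₂ (K.1# ⊕₂ b)}
                (t-E z (1# - x) (trans (sym (+-assoc z 1# (- x)))
                  (cancel-x (trans (+-congʳ e) (+-assoc x y 1#)))))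
                (K.sym {in-t (E y) ⊠₂ (K.1# ⊕₂ b)} {in-t (E (y + 1#))}
                  (K.trans {in-t (E y) ⊠₂ (K.1# ⊕₂ b)} {in-t (E y) ⊠₂ in-t (E 1#)}
                    {in-t (E (y + 1#))}
                    (K.*-congˡ {in-t (E y)} 1+b) (t-E y 1# refl))))
        numerators (inj₂ e) = numerators₂ {a} {b} {c₂} {in-s (E z)} {in-s (E y)} {in-t (E y)}
              {in-s (E x)} {in-t (E z)} {in-t (E (1# - x))} 1+c
              (K.trans {in-s (E y) ⊠₂ in-s (E x)} {in-s (E (z + 1#))}
                {in-s (E z) ⊠₂ (K.1# ⊕₂ a)}
                (s-E y x (trans (+-comm y x) (sym e)))
                (K.sym {in-s (E z) ⊠₂ (K.1# ⊕₂ a)} {in-s (E (z + 1#))}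
                  (K.trans {in-s (E z) ⊠₂ (K.1# ⊕₂ a)} {in-s (E z) ⊠₂ in-s (E 1#)}
                    {in-s (E (z + 1#))}
                    (K.*-congˡ {in-s (E z)} 1+a) (s-E z 1# refl))))
              (t-E z (1# - x) (trans (sym (+-assoc z 1# (- x))) (cancel-x e)))

      generating-identity :
        (s ⊕₂ t) ⊠₂ (in-s Bz ⊠₂ in-t By)
        ≋₂ t ⊠₂ (in-s+t By ⊠₂ in-s Bx) ⊕₂ s ⊠₂ (in-s+t Bz ⊠₂ in-t (τ Bx))
      -- `clear-denominators` proves the equation only after multiplication by s, t and s + t, one
      -- factor for each denominator e^s - 1, e^t - 1 and e^{s+t} - 1.
      generating-identity = s+t-cancel {L} {M} (t-cancel {w ⊠₂ L} {w ⊠₂ M}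
        (s-cancel {t ⊠₂ (w ⊠₂ L)} {t ⊠₂ (w ⊠₂ M)}
          (clear-denominators {s} {t} {w} {a} {b} {c₂} {in-s B₀} {in-t B₀} {in-s+t B₀}
            {in-s Bz} {in-t By} {in-s+t By} {in-s+t Bz} {in-s Bx} {in-t (τ Bx)}
            {in-s (E z)} {in-t (E y)} {in-s (E y) ⊠₂ in-t (E y)} {in-s (E z) ⊠₂ in-t (E z)}
            {in-s (E x)} {in-t (E (1# - x))}
            a-inv b-inv c-inv (from-s isBz) (from-t isBy) (from-s+t isBy) (from-s+t isBz)
            (from-s isBx) (from-t (reflect isBx)) (numerators z≈x+y⊎z+1≈x+y))))
        where
        w L M : Series₂
        w = s ⊕₂ t
        L = w ⊠₂ (in-s Bz ⊠₂ in-t By)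
        M = t ⊠₂ (in-s+t By ⊠₂ in-s Bx) ⊕₂ s ⊠₂ (in-s+t Bz ⊠₂ in-t (τ Bx))

      -- With both degrees positive, multiplication by s, t and s + t follows the `suc` formulas and
      -- no boundary case arises. The shifted series `λ k → By (k +ℕ n)` is the coefficient at
      -- t-degree `n` of By(s + t), as a series in s; likewise `λ k → Bz (m +ℕ k)` is a coefficient
      -- in s, as a series in t.
      generating-identity-coefficients : ∀ m n →
        suc m × (Bz m * By (suc n)) + suc n × (Bz (suc m) * By n)
        ≈ suc n × ((λ k → By (k +ℕ n)) ⊠ Bx) (suc m)
          + suc m × ((λ k → Bz (m +ℕ k)) ⊠ τ Bx) (suc n)
      generating-identity-coefficients m n = begin
        suc m × (Bz m * By (suc n)) + suc n × (Bz (suc m) * By n)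
          ≈⟨ +-cong (×-congʳ (suc m) (in-s-⊠-in-t Bz By m (suc n)))
                    (×-congʳ (suc n) (in-s-⊠-in-t Bz By (suc m) n)) ⟨
        suc m × (in-s Bz ⊠₂ in-t By) m (suc n) + suc n × (in-s Bz ⊠₂ in-t By) (suc m) n
          ≈⟨ s+t-⊠-suc (in-s Bz ⊠₂ in-t By) m n ⟨
        ((s ⊕₂ t) ⊠₂ (in-s Bz ⊠₂ in-t By)) (suc m) (suc n)
          ≈⟨ generating-identity (suc m) (suc n) ⟩
        (t ⊠₂ (in-s+t By ⊠₂ in-s Bx)) (suc m) (suc n)
          + (s ⊠₂ (in-s+t Bz ⊠₂ in-t (τ Bx))) (suc m) (suc n)
          ≈⟨ +-cong (t-⊠-suc (in-s+t By ⊠₂ in-s Bx) (suc m) n)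
                    (s-⊠-suc (in-s+t Bz ⊠₂ in-t (τ Bx)) m (suc n)) ⟩
        suc n × (in-s+t By ⊠₂ in-s Bx) (suc m) n
          + suc m × (in-s+t Bz ⊠₂ in-t (τ Bx)) m (suc n)
          ≈⟨ +-cong (×-congʳ (suc n) (⊠-in-s (in-s+t By) Bx (suc m) n))
                    (×-congʳ (suc m) (⊠-in-t (in-s+t Bz) (τ Bx) m (suc n))) ⟩
        suc n × ((λ k → By (k +ℕ n)) ⊠ Bx) (suc m)
          + suc m × ((λ k → Bz (m +ℕ k)) ⊠ τ Bx) (suc n) ∎
        where open Relation.Binary.Reasoning.Setoid setoid

-- Factorials and binomial coefficients with integer upper entry, in the rationals.

module RationalBinomials where
  open ≡ using (refl; sym; trans; module ≡-Reasoning)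

  private
    -- A fraction `i / suc n` is by definition the normalisation of an unnormalised one.
    -- Multiplicativity of normalisation thus reduces products of fractions to cross-multiplication,
    -- with no reasoning about greatest common divisors.
    fromℚᵘ-* : ∀ p q → fromℚᵘ p ℚ.* fromℚᵘ q ≡ fromℚᵘ (p ℚᵘ.* q)
    fromℚᵘ-* p q = ℚ.toℚᵘ-injective (ℚᵘ.≃-trans (ℚ.toℚᵘ-homo-* (fromℚᵘ p) (fromℚᵘ q))
      (ℚᵘ.≃-trans (ℚᵘ.*-cong (ℚ.toℚᵘ-fromℚᵘ p) (ℚ.toℚᵘ-fromℚᵘ q))
        (ℚᵘ.≃-sym (ℚ.toℚᵘ-fromℚᵘ (p ℚᵘ.* q)))))

    fromℚᵘ-+ : ∀ p q → fromℚᵘ p ℚ.+ fromℚᵘ q ≡ fromℚᵘ (p ℚᵘ.+ q)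
    fromℚᵘ-+ p q = ℚ.toℚᵘ-injective (ℚᵘ.≃-trans (ℚ.toℚᵘ-homo-+ (fromℚᵘ p) (fromℚᵘ q))
      (ℚᵘ.≃-trans (ℚᵘ.+-cong (ℚ.toℚᵘ-fromℚᵘ p) (ℚ.toℚᵘ-fromℚᵘ q))
        (ℚᵘ.≃-sym (ℚ.toℚᵘ-fromℚᵘ (p ℚᵘ.+ q)))))

  /1-* : ∀ i j → (i ℤ.* j) / 1 ≡ i / 1 ℚ.* (j / 1)
  /1-* i j = sym (fromℚᵘ-* (ℚᵘ.mkℚᵘ i 0) (ℚᵘ.mkℚᵘ j 0))

  /1-+ : ∀ i j → (i ℤ.+ j) / 1 ≡ i / 1 ℚ.+ j / 1
  /1-+ i j = sym (trans (fromℚᵘ-+ (ℚᵘ.mkℚᵘ i 0) (ℚᵘ.mkℚᵘ j 0))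
    (cong (_/ 1) (cong₂ ℤ._+_ (ℤ.*-identityʳ i) (ℤ.*-identityʳ j))))

  /≡*1/ : ∀ i n .{{_ : ℕ.NonZero n}} → i / n ≡ i / 1 ℚ.* (+ 1 / n)
  /≡*1/ i (suc n) = sym (trans (fromℚᵘ-* (ℚᵘ.mkℚᵘ i 0) (ℚᵘ.mkℚᵘ (+ 1) n))
    (ℚ.fromℚᵘ-cong {ℚᵘ.mkℚᵘ i 0 ℚᵘ.* ℚᵘ.mkℚᵘ (+ 1) n} {ℚᵘ.mkℚᵘ i n} (ℚᵘ.*≡* (cong₂ ℤ._*_ (ℤ.*-identityʳ i)
      (cong (λ k → + suc k) (sym (ℕ.+-identityʳ n)))))))

  *-inverse : ∀ n .{{_ : ℕ.NonZero n}} → + n / 1 ℚ.* (+ 1 / n) ≡ 1ℚ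
  *-inverse (suc n) = trans (sym (/≡*1/ (+ suc n) (suc n)))
    (ℚ.fromℚᵘ-cong {ℚᵘ.mkℚᵘ (+ suc n) n} {ℚᵘ.mkℚᵘ 1ℤ 0} (ℚᵘ.*≡* (ℤ.*-comm (+ suc n) 1ℤ)))

  fact invFact : ℕ → ℚ
  fact n    = + (n !) / 1
  invFact n = (+ 1 / (n !)) {{n ℕ.!≢0}}

  binomℚ : ℤ → ℕ → ℚ
  binomℚ n k = (fallingFactorial n k / (k !)) {{k ℕ.!≢0}}

  fact*invFact : ∀ n → fact n ℚ.* invFact n ≡ 1ℚ
  fact*invFact n = *-inverse (n !) {{n ℕ.!≢0}}

  fact-suc : ∀ n → fact (suc n) ≡ + suc n / 1 ℚ.* fact n
  fact-suc n = trans (cong (_/ 1) (ℤ.pos-* (suc n) (n !))) (/1-* (+ suc n) (+ (n !)))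

  invFact-suc : ∀ n → + suc n / 1 ℚ.* invFact (suc n) ≡ invFact n
  invFact-suc n = begin
    s ℚ.* g′                       ≡⟨ ℚ.*-identityˡ _ ⟨
    1ℚ ℚ.* (s ℚ.* g′)              ≡⟨ cong (ℚ._* (s ℚ.* g′)) (fact*invFact n) ⟨
    (f ℚ.* g) ℚ.* (s ℚ.* g′)       ≡⟨ rearrange f g s g′ ⟩
    g ℚ.* ((s ℚ.* f) ℚ.* g′)       ≡⟨ cong (λ x → g ℚ.* (x ℚ.* g′)) (fact-suc n) ⟨
    g ℚ.* (fact (suc n) ℚ.* g′)    ≡⟨ cong (g ℚ.*_) (fact*invFact (suc n)) ⟩
    g ℚ.* 1ℚ                       ≡⟨ ℚ.*-identityʳ g ⟩
    g                              ∎
    where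
    open ≡-Reasoning
    s = + suc n / 1
    f = fact n
    g = invFact n
    g′ = invFact (suc n)
    rearrange : ∀ f g s g′ → (f ℚ.* g) ℚ.* (s ℚ.* g′) ≡ g ℚ.* ((s ℚ.* f) ℚ.* g′)
    rearrange = solve 4 (λ f g s g′ → (f :* g) :* (s :* g′) := g :* ((s :* f) :* g′)) refl
      where open Data.Rational.Solver.+-*-Solver

  binomℚ-* : ∀ n k → binomℚ n k ≡ fallingFactorial n k / 1 ℚ.* invFact k
  binomℚ-* n k = /≡*1/ (fallingFactorial n k) (k !) {{k ℕ.!≢0}}

  -- The definition splits off the smallest factor. Pascal's rule compares the upper entries n and n
  -- + 1, whose products share all factors except the largest of one and the smallest of the other,
  -- so the largest must be split off too.
  fallingFactorial-suc : ∀ n k →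
    fallingFactorial (1ℤ ℤ.+ n) (suc k) ≡ (1ℤ ℤ.+ n) ℤ.* fallingFactorial n k
  fallingFactorial-suc n zero    = solve 1 (λ n →
    con 1ℤ :* (con 1ℤ :+ n :- con 0ℤ) := (con 1ℤ :+ n) :* con 1ℤ) refl n
    where open Data.Integer.Solver.+-*-Solver
  fallingFactorial-suc n (suc k) = trans
    (cong (ℤ._* (1ℤ ℤ.+ n -ℤ + suc k)) (fallingFactorial-suc n k))
    (solve 3 (λ n f k → ((con 1ℤ :+ n) :* f) :* (con 1ℤ :+ n :- (con 1ℤ :+ k))
       := (con 1ℤ :+ n) :* (f :* (n :- k))) refl n (fallingFactorial n k) (+ k))
    where open Data.Integer.Solver.+-*-Solver

  fallingFactorial-pascal : ∀ n k → fallingFactorial (1ℤ ℤ.+ n) (suc k)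
    ≡ fallingFactorial n (suc k) ℤ.+ + suc k ℤ.* fallingFactorial n k
  fallingFactorial-pascal n k = trans (fallingFactorial-suc n k)
    (solve 3 (λ n f k → (con 1ℤ :+ n) :* f := f :* (n :- k) :+ (con 1ℤ :+ k) :* f)
      refl n (fallingFactorial n k) (+ k))
    where open Data.Integer.Solver.+-*-Solver

  -- Integer upper entries are essential: p + q - 1 - j reaches -1 at j = p + q, and the rule is
  -- applied there as well.
  pascal : ∀ n k → binomℚ (1ℤ ℤ.+ n) (suc k) ≡ binomℚ n (suc k) ℚ.+ binomℚ n k
  pascal n k = begin
    binomℚ (1ℤ ℤ.+ n) (suc k)
      ≡⟨ binomℚ-* (1ℤ ℤ.+ n) (suc k) ⟩
    fallingFactorial (1ℤ ℤ.+ n) (suc k) / 1 ℚ.* g′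
      ≡⟨ cong (λ i → i / 1 ℚ.* g′) (fallingFactorial-pascal n k) ⟩
    (F′ ℤ.+ + suc k ℤ.* F) / 1 ℚ.* g′
      ≡⟨ cong (ℚ._* g′) (trans (/1-+ F′ (+ suc k ℤ.* F)) (cong (F′ / 1 ℚ.+_) (/1-* (+ suc k) F))) ⟩
    (F′ / 1 ℚ.+ + suc k / 1 ℚ.* (F / 1)) ℚ.* g′
      ≡⟨ rearrange (F′ / 1) (+ suc k / 1) (F / 1) g′ ⟩
    F′ / 1 ℚ.* g′ ℚ.+ F / 1 ℚ.* (+ suc k / 1 ℚ.* g′)
      ≡⟨ cong (λ x → F′ / 1 ℚ.* g′ ℚ.+ F / 1 ℚ.* x) (invFact-suc k) ⟩
    F′ / 1 ℚ.* g′ ℚ.+ F / 1 ℚ.* invFact k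
      ≡⟨ cong₂ ℚ._+_ (binomℚ-* n (suc k)) (binomℚ-* n k) ⟨
    binomℚ n (suc k) ℚ.+ binomℚ n k ∎
    where
    open ≡-Reasoning
    F F′ : ℤ
    F = fallingFactorial n k
    F′ = fallingFactorial n (suc k)
    g′ = invFact (suc k)
    rearrange : ∀ a b c d → (a ℚ.+ b ℚ.* c) ℚ.* d ≡ a ℚ.* d ℚ.+ c ℚ.* (b ℚ.* d)
    rearrange = solve 4 (λ a b c d → (a :+ b :* c) :* d := a :* d :+ c :* (b :* d)) refl
      where open Data.Rational.Solver.+-*-Solver

  fallingFactorial-vanishes : ∀ {n k} → n ℕ.< k → fallingFactorial (+ n) k ≡ 0ℤ
  fallingFactorial-vanishes {n} {suc k} (ℕ.s≤s n≤k) with ℕ.m≤n⇒m<n∨m≡n n≤k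
  ... | inj₁ n<k = cong (ℤ._* (+ n -ℤ + k)) (fallingFactorial-vanishes n<k)
  ... | inj₂ refl = trans (cong (fallingFactorial (+ n) n ℤ.*_) (ℤ.+-inverseʳ (+ n)))
    (ℤ.*-zeroʳ (fallingFactorial (+ n) n))

  binomℚ-vanishes : ∀ {n k} → n ℕ.< k → binomℚ (+ n) k ≡ 0ℚ
  binomℚ-vanishes {n} {k} n<k = trans (binomℚ-* (+ n) k)
    (trans (cong (λ i → i / 1 ℚ.* invFact k) (fallingFactorial-vanishes n<k))
      (ℚ.*-zeroˡ (invFact k)))

  fallingFactorial-! : ∀ m k → fallingFactorial (+ (m +ℕ k)) k ℤ.* + (m !) ≡ + ((m +ℕ k) !)
  fallingFactorial-! m zero = trans (ℤ.*-identityˡ _)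
    (cong (λ n → + (n !)) (sym (ℕ.+-identityʳ m)))
  fallingFactorial-! m (suc k) rewrite ℕ.+-suc m k = begin
    F ℤ.* (+ suc (m +ℕ k) -ℤ + k) ℤ.* + (m !)
      ≡⟨ cong (λ i → F ℤ.* i ℤ.* + (m !)) difference ⟩
    F ℤ.* + suc m ℤ.* + (m !)
      ≡⟨ ℤ.*-assoc F (+ suc m) (+ (m !)) ⟩
    F ℤ.* (+ suc m ℤ.* + (m !))
      ≡⟨ cong (F ℤ.*_) (ℤ.pos-* (suc m) (m !)) ⟨
    F ℤ.* + (suc m !)
      ≡⟨ fallingFactorial-! (suc m) k ⟩
    + (suc (m +ℕ k) !) ∎
    where
    open ≡-Reasoning
    F = fallingFactorial (+ suc (m +ℕ k)) k
    difference : + suc (m +ℕ k) -ℤ + k ≡ + suc m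
    difference = solve 2 (λ m k → m :+ k :- k := m) refl (+ suc m) (+ k)
      where open Data.Integer.Solver.+-*-Solver

  binomℚ-fact : ∀ m k → binomℚ (+ (m +ℕ k)) k ≡ fact (m +ℕ k) ℚ.* (invFact m ℚ.* invFact k)
  binomℚ-fact m k = begin
    binomℚ (+ (m +ℕ k)) k                        ≡⟨ binomℚ-* (+ (m +ℕ k)) k ⟩
    F ℚ.* invFact k                              ≡⟨ cong (ℚ._* invFact k) (ℚ.*-identityʳ F) ⟨
    (F ℚ.* 1ℚ) ℚ.* invFact k                     ≡⟨ cong (λ x → (F ℚ.* x) ℚ.* invFact k) (fact*invFact m) ⟨
    (F ℚ.* (fact m ℚ.* invFact m)) ℚ.* invFact k ≡⟨ rearrange F (fact m) (invFact m) (invFact k) ⟩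
    (F ℚ.* fact m) ℚ.* (invFact m ℚ.* invFact k)
      ≡⟨ cong (ℚ._* (invFact m ℚ.* invFact k))
           (trans (sym (/1-* (fallingFactorial (+ (m +ℕ k)) k) (+ (m !))))
             (cong (_/ 1) (fallingFactorial-! m k))) ⟩
    fact (m +ℕ k) ℚ.* (invFact m ℚ.* invFact k)  ∎
    where
    open ≡-Reasoning
    F = fallingFactorial (+ (m +ℕ k)) k / 1
    rearrange : ∀ a b c d → (a ℚ.* (b ℚ.* c)) ℚ.* d ≡ (a ℚ.* b) ℚ.* (c ℚ.* d)
    rearrange = solve 4 (λ a b c d → (a :* (b :* c)) :* d := (a :* b) :* (c :* d)) refl
      where open Data.Rational.Solver.+-*-Solver

  binomℚ-diag : ∀ n → binomℚ (+ n) n ≡ 1ℚ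
  binomℚ-diag n = trans (binomℚ-fact 0 n)
    (trans (cong (fact n ℚ.*_) (ℚ.*-identityˡ (invFact n))) (fact*invFact n))

-- Ordinary coefficients over a commutative ring that receives the rationals.

module ℚ-Algebra {c ℓ} (A : CommutativeRing c ℓ) (ι : ℚ → CommutativeRing.Carrier A)
  (ι-isRingHomomorphism :
    IsRingHomomorphism ℚ.+-*-rawRing (CommutativeRing.rawRing A) ι) where
  open CommutativeRing A hiding (zero)
  open IsRingHomomorphism ι-isRingHomomorphism
    using (⟦⟧-cong; +-homo; *-homo; 0#-homo; 1#-homo)
  open Algebra.Properties.Ring ring using (+-cancelʳ)
  open Algebra.Properties.Semiring.Mult semiring using (_×_; ×-congʳ; ×-assoc-*; ×-comm-*)
  open Algebra.Properties.Semiring.Exp semiring using (_^_)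
  open Algebra.Properties.Semiring.Sum semiring
    using (sum; sum-cong-≋; ∑-distrib-+; *-distribˡ-sum; sum-replicate-zero)
  open Algebra.Solver.Ring.NaturalCoefficients.Default commutativeSemiring
    using (solve; _:=_; _:+_; _:*_)
  open Relation.Binary.Reasoning.Setoid setoid
  open RationalBinomials
  open Hurwitz A
  open Exponentials A

  ∑≤ : ℕ → (ℕ → Carrier) → Carrier
  ∑≤ n f = sum {suc n} (λ i → f (toℕ i))

  ∑≤-cong : ∀ n {f g} → (∀ j → j ≤ℕ n → f j ≈ g j) → ∑≤ n f ≈ ∑≤ n g
  ∑≤-cong n e = sum-cong-≋ {suc n} λ i → e (toℕ i) (toℕ≤pred[n] i)

  ∑≤-+ : ∀ n f g → ∑≤ n (λ j → f j + g j) ≈ ∑≤ n f + ∑≤ n g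
  ∑≤-+ n f g = ∑-distrib-+ {suc n} (λ i → f (toℕ i)) (λ i → g (toℕ i))

  *-∑≤ : ∀ x n f → x * ∑≤ n f ≈ ∑≤ n (λ j → x * f j)
  *-∑≤ x n f = *-distribˡ-sum {suc n} x (λ i → f (toℕ i))

  ∑≤-zero : ∀ n {f} → (∀ j → j ≤ℕ n → f j ≈ 0#) → ∑≤ n f ≈ 0#
  ∑≤-zero n e = trans (∑≤-cong n e) (sum-replicate-zero (suc n))

  ∑≤-extend : ∀ {m n} f → m ≤ℕ n → (∀ j → m ℕ.< j → j ≤ℕ n → f j ≈ 0#) →
              ∑≤ m f ≈ ∑≤ n f
  ∑≤-extend {n = zero}  f z≤n       e = refl
  ∑≤-extend {n = suc n} f z≤n       e =
    +-congˡ (sym (∑≤-zero n λ j j≤n → e (suc j) (s≤s z≤n) (s≤s j≤n)))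
  ∑≤-extend             f (s≤s m≤n) e =
    +-congˡ (∑≤-extend (λ j → f (suc j)) m≤n λ j m<j j≤n → e (suc j) (s≤s m<j) (s≤s j≤n))

  ×≈* : ∀ n x → n × x ≈ ι (+ n / 1) * x
  ×≈* zero    x = sym (trans (*-congʳ 0#-homo) (zeroˡ x))
  ×≈* (suc n) x = begin
    x + n × x                         ≈⟨ +-cong (sym (trans (*-congʳ 1#-homo) (*-identityˡ x))) (×≈* n x) ⟩
    ι 1ℚ * x + ι (+ n / 1) * x        ≈⟨ distribʳ x _ _ ⟨
    (ι 1ℚ + ι (+ n / 1)) * x          ≈⟨ *-congʳ (+-homo 1ℚ (+ n / 1)) ⟨
    ι (1ℚ ℚ.+ + n / 1) * x            ≈⟨ *-congʳ (⟦⟧-cong (/1-+ 1ℤ (+ n))) ⟨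
    ι (+ suc n / 1) * x               ∎

  torsionFree : TorsionFree
  torsionFree n {x} {y} e = begin
    x                     ≈⟨ unscale x ⟨
    r * (suc n × x)       ≈⟨ *-congˡ e ⟩
    r * (suc n × y)       ≈⟨ unscale y ⟩
    y                     ∎
    where
    r = ι (+ 1 / suc n)
    unscale : ∀ u → r * (suc n × u) ≈ u
    unscale u = begin
      r * (suc n × u)                  ≈⟨ *-congˡ (×≈* (suc n) u) ⟩
      r * (ι (+ suc n / 1) * u)        ≈⟨ solve 3 (λ a b c → a :* (b :* c) := (b :* a) :* c) refl r _ u ⟩
      (ι (+ suc n / 1) * r) * u        ≈⟨ *-congʳ (*-homo _ _) ⟨
      ι (+ suc n / 1 ℚ.* (+ 1 / suc n)) * u ≈⟨ *-congʳ (⟦⟧-cong (*-inverse (suc n))) ⟩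
      ι 1ℚ * u                         ≈⟨ *-congʳ 1#-homo ⟩
      1# * u                           ≈⟨ *-identityˡ u ⟩
      u                                ∎

  factorial 1/! : ℕ → Carrier
  factorial n = ι (fact n)
  1/! n = ι (invFact n)

  binom : ℤ → ℕ → Carrier
  binom n k = ι (binomℚ n k)

  factorial-1/! : ∀ n → factorial n * 1/! n ≈ 1#
  factorial-1/! n = trans (sym (*-homo _ _)) (trans (⟦⟧-cong (fact*invFact n)) 1#-homo)

  1/!-suc : ∀ n → suc n × 1/! (suc n) ≈ 1/! n
  1/!-suc n = trans (×≈* (suc n) _) (trans (sym (*-homo _ _)) (⟦⟧-cong (invFact-suc n)))

  binom-pascal : ∀ n k → binom (1ℤ ℤ.+ n) (suc k) ≈ binom n (suc k) + binom n k
  binom-pascal n k = trans (⟦⟧-cong (pascal n k)) (+-homo _ _)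

  binom-vanishes : ∀ {n k} → n ℕ.< k → binom (+ n) k ≈ 0#
  binom-vanishes n<k = trans (⟦⟧-cong (binomℚ-vanishes n<k)) 0#-homo

  binom-diag : ∀ n → binom (+ n) n ≈ 1#
  binom-diag n = trans (⟦⟧-cong (binomℚ-diag n)) 1#-homo

  binom-fact : ∀ m k → binom (+ (m +ℕ k)) k ≈ factorial (m +ℕ k) * (1/! m * 1/! k)
  binom-fact m k = trans (⟦⟧-cong (binomℚ-fact m k)) (trans (*-homo _ _) (*-congˡ (*-homo _ _)))

  -- Ordinary coefficients of the series with exponential coefficients F.
  ord : Series → Series
  ord F n = F n * 1/! n

  cauchyProduct : Series → Series → Series
  cauchyProduct f g n = ∑≤ n (λ k → f k * g (n ∸ k))

  -- d/dt on ordinary coefficients.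
  θ : Series → Series
  θ f n = suc n × f (suc n)

  cauchyProduct-cong : ∀ {f f′ g g′} → f ≋ f′ → g ≋ g′ → cauchyProduct f g ≋ cauchyProduct f′ g′
  cauchyProduct-cong e e′ n = ∑≤-cong n λ k _ → *-cong (e k) (e′ (n ∸ k))

  cauchyProduct-⊕ : ∀ f f′ g → cauchyProduct (f ⊕ f′) g ≋ cauchyProduct f g ⊕ cauchyProduct f′ g
  cauchyProduct-⊕ f f′ g n = trans
    (∑≤-cong n λ k _ → distribʳ (g (n ∸ k)) (f k) (f′ k))
    (∑≤-+ n (λ k → f k * g (n ∸ k)) (λ k → f′ k * g (n ∸ k)))

  -- Makes the Cauchy product obey the same recursion that defines `⊠`, so the two products can be
  -- compared degree by degree. The induction splits off the term k = 0.
  leibniz : ∀ f g → cauchyProduct (θ f) g ⊕ cauchyProduct f (θ g) ≋ θ (cauchyProduct f g)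
  leibniz f g zero    = begin
    ((f 1 + 0#) * g 0 + 0#) + (f 0 * (g 1 + 0#) + 0#)
      ≈⟨ +-cong (+-identityʳ _) (+-identityʳ _) ⟩
    (f 1 + 0#) * g 0 + f 0 * (g 1 + 0#)
      ≈⟨ +-cong (*-congʳ (+-identityʳ _)) (*-congˡ (+-identityʳ _)) ⟩
    f 1 * g 0 + f 0 * g 1
      ≈⟨ +-comm _ _ ⟩
    f 0 * g 1 + f 1 * g 0
      ≈⟨ +-congˡ (+-identityʳ _) ⟨
    f 0 * g 1 + (f 1 * g 0 + 0#)
      ≈⟨ +-identityʳ _ ⟨
    (f 0 * g 1 + (f 1 * g 0 + 0#)) + 0# ∎
  leibniz f g (suc n) = begin
    -- The shift of `θ f` is `D (D f) ⊕ θ (D f)`, because (k+2) f(k+2) = f(k+2) + (k+1) f(k+2).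
    ((1 × f 1) * g (suc n) + cauchyProduct (D (D f) ⊕ θ (D f)) g n)
      + (f 0 * (suc (suc n) × g (suc (suc n))) + cauchyProduct (D f) (θ g) n)
      ≈⟨ +-cong (+-cong (*-congʳ (+-identityʳ _)) (cauchyProduct-⊕ (D (D f)) (θ (D f)) g n))
                (+-congʳ (×-comm-* (suc (suc n)) (f 0) (g (suc (suc n))))) ⟩
    (f 1 * g (suc n) + (cauchyProduct (D (D f)) g n + cauchyProduct (θ (D f)) g n))
      + ((f0g + suc n × f0g) + cauchyProduct (D f) (θ g) n)
      ≈⟨ solve 6 (λ a b c d e f → (a :+ (b :+ c)) :+ ((d :+ e) :+ f)
           := (d :+ (a :+ b)) :+ (e :+ (c :+ f))) refl _ _ _ _ _ _ ⟩
    (f0g + cauchyProduct (D f) g (suc n))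
      + (suc n × f0g + (cauchyProduct (θ (D f)) g n + cauchyProduct (D f) (θ g) n))
      ≈⟨ +-congˡ (+-congˡ (leibniz (D f) g n)) ⟩
    (f0g + cauchyProduct (D f) g (suc n))
      + (suc n × f0g + suc n × cauchyProduct (D f) g (suc n))
      ≈⟨ +-congˡ (×-distrib-+ f0g (cauchyProduct (D f) g (suc n)) (suc n)) ⟨
    suc (suc n) × (f0g + cauchyProduct (D f) g (suc n)) ∎
    where
    f0g = f 0 * g (suc (suc n))
    open Algebra.Properties.CommutativeMonoid.Mult +-commutativeMonoid
      using (×-distrib-+)

  θ-ord : ∀ F → θ (ord F) ≋ ord (D F)
  θ-ord F n = trans (sym (×-comm-* (suc n) (F (suc n)) (1/! (suc n)))) (*-congˡ (1/!-suc n))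

  -- Both sides have the same constant term and, by `leibniz` and induction, the same derivative;
  -- torsion-freeness removes the factor `suc n`.
  ord-⊠ : ∀ F G → ord (F ⊠ G) ≋ cauchyProduct (ord F) (ord G)
  ord-⊠ F G zero    = begin
    (F 0 * G 0) * 1/! 0               ≈⟨ *-identityʳ _ ⟨
    (F 0 * G 0) * 1/! 0 * 1#          ≈⟨ *-congˡ 1#-homo ⟨
    (F 0 * G 0) * 1/! 0 * 1/! 0       ≈⟨ solve 3 (λ a b c → a :* b :* c :* c := (a :* c) :* (b :* c)) refl _ _ _ ⟩
    (F 0 * 1/! 0) * (G 0 * 1/! 0)     ≈⟨ +-identityʳ _ ⟨
    (F 0 * 1/! 0) * (G 0 * 1/! 0) + 0# ∎
  ord-⊠ F G (suc n) = torsionFree n (begin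
    θ (ord (F ⊠ G)) n
      ≈⟨ θ-ord (F ⊠ G) n ⟩
    ((D F ⊠ G) n + (F ⊠ D G) n) * 1/! n
      ≈⟨ distribʳ _ _ _ ⟩
    ord (D F ⊠ G) n + ord (F ⊠ D G) n
      ≈⟨ +-cong (ord-⊠ (D F) G n) (ord-⊠ F (D G) n) ⟩
    cauchyProduct (ord (D F)) (ord G) n + cauchyProduct (ord F) (ord (D G)) n
      ≈⟨ +-cong (cauchyProduct-cong {g = ord G} (θ-ord F) (λ _ → refl) n)
                (cauchyProduct-cong {ord F} (λ _ → refl) (θ-ord G) n) ⟨
    cauchyProduct (θ (ord F)) (ord G) n + cauchyProduct (ord F) (θ (ord G)) n
      ≈⟨ leibniz (ord F) (ord G) n ⟩
    θ (cauchyProduct (ord F) (ord G)) n ∎)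

  ord-injective : ∀ {F G} → ord F ≋ ord G → F ≋ G
  ord-injective {F} {G} e n = begin
    F n                     ≈⟨ un F ⟨
    factorial n * ord F n   ≈⟨ *-congˡ (e n) ⟩
    factorial n * ord G n   ≈⟨ un G ⟩
    G n                     ∎
    where
    un : ∀ H → factorial n * ord H n ≈ H n
    un H = trans (solve 3 (λ a b c → a :* (b :* c) := (a :* c) :* b) refl _ _ _)
      (trans (*-congʳ (factorial-1/! n)) (*-identityˡ _))

  ord-X⊠E-zero : ∀ x → ord (X ⊠ E x) 0 ≈ 0#
  ord-X⊠E-zero x = trans (*-congʳ (X-⊠-zero (E x))) (zeroˡ _)

  ord-X⊠E-suc : ∀ x n → ord (X ⊠ E x) (suc n) ≈ ord (E x) n
  ord-X⊠E-suc x n = begin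
    (X ⊠ E x) (suc n) * 1/! (suc n)   ≈⟨ *-congʳ (X-⊠-suc (E x) n) ⟩
    (suc n × E x n) * 1/! (suc n)     ≈⟨ ×-assoc-* (suc n) _ _ ⟩
    suc n × (E x n * 1/! (suc n))     ≈⟨ ×-comm-* (suc n) _ _ ⟨
    E x n * (suc n × 1/! (suc n))     ≈⟨ *-congˡ (1/!-suc n) ⟩
    E x n * 1/! n                     ∎

  -- This is the coefficient of s^k t^n in F(s + t), where (s + t)^{k+n} contributes its binomial
  -- coefficient. The second binomial in each sum of the theorem originates here.
  shift-ord : ∀ F k n → (F (k +ℕ n) * 1/! k) * 1/! n ≈ binom (+ (k +ℕ n)) n * ord F (k +ℕ n)
  shift-ord F k n = sym (begin
    binom (+ (k +ℕ n)) n * (F′ * 1/! (k +ℕ n))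
      ≈⟨ *-congʳ (binom-fact k n) ⟩
    (factorial (k +ℕ n) * (1/! k * 1/! n)) * (F′ * 1/! (k +ℕ n))
      ≈⟨ solve 5 (λ a b c d e → (a :* (b :* c)) :* (d :* e) := (a :* e) :* ((d :* b) :* c))
           refl _ _ _ _ _ ⟩
    (factorial (k +ℕ n) * 1/! (k +ℕ n)) * ((F′ * 1/! k) * 1/! n)
      ≈⟨ *-congʳ (factorial-1/! (k +ℕ n)) ⟩
    1# * ((F′ * 1/! k) * 1/! n)
      ≈⟨ *-identityˡ _ ⟩
    (F′ * 1/! k) * 1/! n ∎)
    where F′ = F (k +ℕ n)

  IsBernoulli-zero : ∀ {x F} → IsBernoulli x F → F 0 ≈ 1#
  IsBernoulli-zero {x} {F} isF = begin
    F 0                   ≈⟨ unit-term ⟨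
    1# * F 0 + 0# * F 1   ≈⟨ isF 1 ⟩
    1# * 1# + 0# * (x * 1#) ≈⟨ +-cong (*-identityˡ 1#) (zeroˡ _) ⟩
    1# + 0#               ≈⟨ +-identityʳ 1# ⟩
    1#                    ∎
    where
    unit-term : 1# * F 0 + 0# * F 1 ≈ F 0
    unit-term = trans (+-cong (*-identityˡ _) (zeroˡ _)) (+-identityʳ _)

  predecessor : ∀ {j n} → j ≤ℕ n → 1ℤ ℤ.+ (+ n -ℤ 1ℤ -ℤ + j) ≡ + (n ∸ j)
  predecessor {j} {n} j≤n = ≡.trans
    (solveℤ (+ n) (+ j)) (≡.trans (ℤ.m-n≡m⊖n n j) (ℤ.⊖-≥ j≤n))
    where
    open Data.Integer.Solver.+-*-Solver renaming (solve to solve′; _:=_ to _:=′_; _:+_ to _:+′_)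
    solveℤ : ∀ n j → 1ℤ ℤ.+ (n -ℤ 1ℤ -ℤ j) ≡ n -ℤ j
    solveℤ = solve′ 2 (λ n j → con 1ℤ :+′ (n :- con 1ℤ :- j) :=′ n :- j) ≡.refl

  -- The boundary j = n is included: the upper entry is then -1, the two terms on the left have
  -- opposite signs, and the right side is a binomial with upper entry 0 and positive lower entry.
  binom-step : ∀ {j n} k → j ≤ℕ n →
    binom (+ n -ℤ 1ℤ -ℤ + j) (suc k) + binom (+ n -ℤ 1ℤ -ℤ + j) k ≈ binom (+ (n ∸ j)) (suc k)
  binom-step {j} {n} k j≤n = trans (sym (binom-pascal _ k))
    (⟦⟧-cong (cong (λ i → binomℚ i (suc k)) (predecessor j≤n)))

  -- From the generating function identity to the formula for products of Bernoulli values.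

  module _ {x y z : Carrier} {Bx By Bz B₀ : Series}
    (isBx : IsBernoulli x Bx) (isBy : IsBernoulli y By)
    (isBz : IsBernoulli z Bz) (isB₀ : IsBernoulli 0# B₀)
    (z≈x+y⊎z+1≈x+y : z ≈ x + y ⊎ z + 1# ≈ x + y) where

    private
      bx by bz : Series
      bx = ord Bx
      by = ord By
      bz = ord Bz

      YX ZX : ℕ → ℕ → Carrier
      YX n j = by (n ∸ j) * bx j
      ZX n h = (- 1#) ^ h * (bz (n ∸ h) * bx h)

      first-coefficient : ∀ m r n → suc m +ℕ r ≡ n →
        ((λ k → By (k +ℕ r)) ⊠ Bx) (suc m) * 1/! (suc m) * 1/! r
        ≈ ∑≤ n (λ j → binom (+ (n ∸ j)) r * YX n j)
      first-coefficient m r n ≡.refl = begin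
        (By′ ⊠ Bx) (suc m) * 1/! (suc m) * 1/! r
          ≈⟨ *-congʳ (trans (*-congʳ (⊠-comm By′ Bx (suc m))) (ord-⊠ Bx By′ (suc m))) ⟩
        cauchyProduct bx (ord By′) (suc m) * 1/! r
          ≈⟨ trans (*-comm _ _) (*-∑≤ (1/! r) (suc m) (λ j → bx j * ord By′ (suc m ∸ j))) ⟩
        ∑≤ (suc m) (λ j → 1/! r * (bx j * ord By′ (suc m ∸ j)))
          ≈⟨ ∑≤-cong (suc m) term ⟩
        ∑≤ (suc m) (λ j → binom (+ (n ∸ j)) r * YX n j)
          -- For j > m + 1 the upper entry n - j is smaller than `r`, so the new terms vanish. The
          -- range then depends on `n` alone, which stays fixed during the induction.
          ≈⟨ ∑≤-extend (λ j → binom (+ (n ∸ j)) r * YX n j) (ℕ.m≤m+n (suc m) r) vanish ⟩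
        ∑≤ n (λ j → binom (+ (n ∸ j)) r * YX n j) ∎
        where
        By′ : Series
        By′ k = By (k +ℕ r)
        term : ∀ j → j ≤ℕ suc m →
          1/! r * (bx j * ord By′ (suc m ∸ j)) ≈ binom (+ (n ∸ j)) r * YX n j
        term j j≤m = begin
          1/! r * (bx j * ord By′ (suc m ∸ j))
            ≈⟨ solve 3 (λ a b c → a :* (b :* c) := (c :* a) :* b) refl _ _ _ ⟩
          (ord By′ (suc m ∸ j) * 1/! r) * bx j
            ≈⟨ *-congʳ (shift-ord By (suc m ∸ j) r) ⟩
          (binom (+ (suc m ∸ j +ℕ r)) r * by (suc m ∸ j +ℕ r)) * bx j
            ≈⟨ *-assoc _ _ _ ⟩
          binom (+ (suc m ∸ j +ℕ r)) r * (by (suc m ∸ j +ℕ r) * bx j)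
            ≡⟨ cong (λ k → binom (+ k) r * (by k * bx j)) (≡.sym (ℕ.+-∸-comm r j≤m)) ⟩
          binom (+ (n ∸ j)) r * YX n j ∎
        vanish : ∀ j → suc m ℕ.< j → j ≤ℕ n → binom (+ (n ∸ j)) r * YX n j ≈ 0#
        vanish j m<j j≤n = trans (*-congʳ (binom-vanishes
          (≡.subst (n ∸ j ℕ.<_) (ℕ.m+n∸m≡n (suc m) r) (ℕ.∸-monoʳ-< m<j j≤n)))) (zeroˡ _)

      second-coefficient : ∀ m r n → m +ℕ r ≡ n →
        ((λ k → Bz (m +ℕ k)) ⊠ τ Bx) r * 1/! r * 1/! m
        ≈ ∑≤ r (λ h → binom (+ (n ∸ h)) m * ZX n h)
      second-coefficient m r n ≡.refl = begin
        (Bz′ ⊠ τ Bx) r * 1/! r * 1/! m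
          ≈⟨ *-congʳ (trans (*-congʳ (⊠-comm Bz′ (τ Bx) r)) (ord-⊠ (τ Bx) Bz′ r)) ⟩
        cauchyProduct (ord (τ Bx)) (ord Bz′) r * 1/! m
          ≈⟨ trans (*-comm _ _) (*-∑≤ (1/! m) r (λ h → ord (τ Bx) h * ord Bz′ (r ∸ h))) ⟩
        ∑≤ r (λ h → 1/! m * (ord (τ Bx) h * ord Bz′ (r ∸ h)))
          ≈⟨ ∑≤-cong r term ⟩
        ∑≤ r (λ h → binom (+ (n ∸ h)) m * ZX n h) ∎
        where
        Bz′ : Series
        Bz′ k = Bz (m +ℕ k)
        term : ∀ h → h ≤ℕ r →
          1/! m * (ord (τ Bx) h * ord Bz′ (r ∸ h)) ≈ binom (+ (n ∸ h)) m * ZX n h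
        term h h≤r = begin
          1/! m * ((((- 1#) ^ h * Bx h) * 1/! h) * (Bz (m +ℕ (r ∸ h)) * 1/! (r ∸ h)))
            ≡⟨ cong (λ k → 1/! m * ((((- 1#) ^ h * Bx h) * 1/! h) * (Bz k * 1/! (r ∸ h)))) (ℕ.+-comm m (r ∸ h)) ⟩
          1/! m * ((((- 1#) ^ h * Bx h) * 1/! h) * (Bz (r ∸ h +ℕ m) * 1/! (r ∸ h)))
            ≈⟨ solve 6 (λ a b c d e f → a :* (((b :* c) :* d) :* (e :* f))
                 := ((e :* f) :* a) :* (b :* (c :* d))) refl _ _ _ _ _ _ ⟩
          ((Bz (r ∸ h +ℕ m) * 1/! (r ∸ h)) * 1/! m) * ((- 1#) ^ h * bx h)
            ≈⟨ *-congʳ (shift-ord Bz (r ∸ h) m) ⟩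
          (binom (+ (r ∸ h +ℕ m)) m * bz (r ∸ h +ℕ m)) * ((- 1#) ^ h * bx h)
            ≈⟨ solve 4 (λ a b c d → (a :* b) :* (c :* d) := a :* (c :* (b :* d))) refl _ _ _ _ ⟩
          binom (+ (r ∸ h +ℕ m)) m * ((- 1#) ^ h * (bz (r ∸ h +ℕ m) * bx h))
            ≡⟨ cong (λ k → binom (+ k) m * ((- 1#) ^ h * (bz k * bx h)))
                 (≡.trans (ℕ.+-comm (r ∸ h) m) (≡.sym (ℕ.+-∸-assoc m h≤r))) ⟩
          binom (+ (n ∸ h)) m * ZX n h ∎

      -- The coefficient identity is divided by (m+1)! (r+1)!; each factor `suc m` or `suc r` lowers
      -- one of the two factorials, and no numerical factor survives.
      coefficient-recurrence : ∀ m r n → m +ℕ suc r ≡ n →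
        bz m * by (suc r) + bz (suc m) * by r
        ≈ ∑≤ n (λ j → binom (+ (n ∸ j)) r * YX n j)
          + ∑≤ (suc r) (λ h → binom (+ (n ∸ h)) m * ZX n h)
      coefficient-recurrence m r n eq = begin
        (Bz m * 1/! m) * (By (suc r) * g′) + (Bz (suc m) * f′) * (By r * 1/! r)
          ≈⟨ +-cong (*-congʳ (*-congˡ (1/!-suc m))) (*-congˡ (*-congˡ (1/!-suc r))) ⟨
        (Bz m * (suc m × f′)) * (By (suc r) * g′) + (Bz (suc m) * f′) * (By r * (suc r × g′))
          ≈⟨ +-cong lhs₁ lhs₂ ⟨
        (suc m × (Bz m * By (suc r))) * (f′ * g′) + (suc r × (Bz (suc m) * By r)) * (f′ * g′)
          ≈⟨ distribʳ _ _ _ ⟨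
        (suc m × (Bz m * By (suc r)) + suc r × (Bz (suc m) * By r)) * (f′ * g′)
          ≈⟨ *-congʳ (Bivariate.generating-identity-coefficients A torsionFree
               isBx isBy isBz isB₀ z≈x+y⊎z+1≈x+y m r) ⟩
        (suc r × P + suc m × Q) * (f′ * g′)
          ≈⟨ distribʳ _ _ _ ⟩
        (suc r × P) * (f′ * g′) + (suc m × Q) * (f′ * g′)
          ≈⟨ +-cong rhs₁ rhs₂ ⟩
        P * f′ * (suc r × g′) + Q * g′ * (suc m × f′)
          ≈⟨ +-cong (*-congˡ (1/!-suc r)) (*-congˡ (1/!-suc m)) ⟩
        P * f′ * 1/! r + Q * g′ * 1/! m
          ≈⟨ +-cong (first-coefficient m r n (≡.trans (≡.sym (ℕ.+-suc m r)) eq))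
                    (second-coefficient m (suc r) n eq) ⟩
        ∑≤ n (λ j → binom (+ (n ∸ j)) r * YX n j)
          + ∑≤ (suc r) (λ h → binom (+ (n ∸ h)) m * ZX n h) ∎
        where
        f′ g′ P Q : Carrier
        f′ = 1/! (suc m)
        g′ = 1/! (suc r)
        P = ((λ k → By (k +ℕ r)) ⊠ Bx) (suc m)
        Q = ((λ k → Bz (m +ℕ k)) ⊠ τ Bx) (suc r)
        move : ∀ n u v w → (n × u) * (v * w) ≈ u * v * (n × w)
        move n u v w = trans (×-assoc-* n u (v * w))
          (trans (×-congʳ n (sym (*-assoc u v w))) (sym (×-comm-* n (u * v) w)))
        swap : ∀ n u v w → (n × u) * (v * w) ≈ u * w * (n × v)
        swap n u v w = trans (*-congˡ (*-comm v w)) (move n u w v)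
        lhs₁ : (suc m × (Bz m * By (suc r))) * (f′ * g′)
               ≈ (Bz m * (suc m × f′)) * (By (suc r) * g′)
        lhs₁ = trans (swap (suc m) _ f′ g′)
          (solve 4 (λ a b c d → (a :* b) :* c :* d := (a :* d) :* (b :* c)) refl _ _ _ _)
        lhs₂ : (suc r × (Bz (suc m) * By r)) * (f′ * g′)
               ≈ (Bz (suc m) * f′) * (By r * (suc r × g′))
        lhs₂ = trans (move (suc r) _ f′ g′)
          (solve 4 (λ a b c d → (a :* b) :* c :* d := (a :* c) :* (b :* d)) refl _ _ _ _)
        rhs₁ : (suc r × P) * (f′ * g′) ≈ P * f′ * (suc r × g′)
        rhs₁ = move (suc r) P f′ g′
        rhs₂ : (suc m × Q) * (f′ * g′) ≈ Q * g′ * (suc m × f′)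
        rhs₂ = swap (suc m) Q f′ g′

      u v : ℕ → ℕ → ℕ → Carrier
      u n r j = binom (+ n -ℤ 1ℤ -ℤ + j) r * YX n j
      v n p h = binom (+ n -ℤ 1ℤ -ℤ + h) p * ZX n h

      -- The junk value U n 0 = 0 makes the formula hold for q = 0, the base of the induction.
      U : ℕ → ℕ → Carrier
      U n zero    = 0#
      U n (suc r) = ∑≤ n (u n r)

      V : ℕ → ℕ → ℕ → Carrier
      V n p q = ∑≤ q (v n p)

      -- The recurrence adds two neighbouring products with the same total `n`. Pascal's rule splits
      -- binom(n-j, r) into the coefficients belonging to these two products, which accounts for the
      -- upper entry n - 1 - j.
      U-step : ∀ n r → U n (suc r) + U n r ≈ ∑≤ n (λ j → binom (+ (n ∸ j)) r * YX n j)
      U-step n zero    = +-identityʳ _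
      U-step n (suc r) = trans (sym (∑≤-+ n (u n (suc r)) (u n r))) (∑≤-cong n λ j j≤n →
        trans (sym (distribʳ (YX n j) _ _)) (*-congʳ (binom-step r j≤n)))

      V-step : ∀ n p r → suc p +ℕ suc r ≡ n →
        V n p (suc r) + V n (suc p) r ≈ ∑≤ (suc r) (λ h → binom (+ (n ∸ h)) (suc p) * ZX n h)
      V-step n p r ≡.refl = begin
        V n p (suc r) + V n (suc p) r
          -- The two ranges differ by the term h = r + 1, whose upper entry n - 1 - h equals `p`,
          -- just below the lower entry `suc p`; adding it changes nothing.
          ≈⟨ +-congˡ (∑≤-extend {r} (v n (suc p)) (ℕ.n≤1+n r) vanish) ⟩
        V n p (suc r) + V n (suc p) (suc r)
          ≈⟨ +-comm _ _ ⟩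
        V n (suc p) (suc r) + V n p (suc r)
          ≈⟨ ∑≤-+ (suc r) (v n (suc p)) (v n p) ⟨
        ∑≤ (suc r) (λ h → v n (suc p) h + v n p h)
          ≈⟨ ∑≤-cong (suc r) (λ h h≤r → trans (sym (distribʳ (ZX n h) _ _))
               (*-congʳ (binom-step p (ℕ.≤-trans h≤r (ℕ.m≤n+m (suc r) (suc p)))))) ⟩
        ∑≤ (suc r) (λ h → binom (+ (n ∸ h)) (suc p) * ZX n h) ∎
        where
        top : + (suc p +ℕ suc r) -ℤ 1ℤ -ℤ + suc r ≡ + p
        top = solve′ 2 (λ p r → (con 1ℤ :+′ p :+′ r) :- con 1ℤ :- r :=′ p) ≡.refl (+ p) (+ suc r)
          where open Data.Integer.Solver.+-*-Solver renaming (solve to solve′; _:=_ to _:=′_; _:+_ to _:+′_)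
        vanish : ∀ h → r ℕ.< h → h ≤ℕ suc r → v n (suc p) h ≈ 0#
        vanish h r<h h≤r with ℕ.≤-antisym h≤r r<h
        ... | ≡.refl = trans (*-congʳ (trans (⟦⟧-cong (cong (λ i → binomℚ i (suc p)) top))
          (binom-vanishes (ℕ.n<1+n p)))) (zeroˡ _)

      -- The recurrence links (p, q) to (p + 1, q - 1), so `p` must vary: it rises as `q` falls, and
      -- the total `n` is kept.
      product-formula : ∀ p q n → suc p +ℕ q ≡ n → bz (suc p) * by q ≈ U n q + V n p q
      product-formula p zero n eq with ≡.trans (≡.sym (ℕ.+-identityʳ (suc p))) eq
      ... | ≡.refl = begin
        bz (suc p) * by 0
          -- The zeroth Bernoulli polynomial is 1 at every argument, so `by 0` may be replaced by
          -- `bx 0`; the product then is the only term, h = 0, of `V`.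
          ≈⟨ *-congˡ (*-congʳ (trans (IsBernoulli-zero isBy) (sym (IsBernoulli-zero isBx)))) ⟩
        bz (suc p) * bx 0
          ≈⟨ *-identityˡ _ ⟨
        1# * (bz (suc p) * bx 0)
          ≈⟨ *-identityˡ _ ⟨
        1# * ZX (suc p) 0
          ≈⟨ *-congʳ (binom-diag p) ⟨
        binom (+ p) p * ZX (suc p) 0
          ≡⟨ cong (λ i → binom i p * ZX (suc p) 0) (≡.sym (ℤ.+-identityʳ (+ p))) ⟩
        binom (+ suc p -ℤ 1ℤ -ℤ 0ℤ) p * ZX (suc p) 0
          ≈⟨ trans (+-identityˡ _) (+-identityʳ _) ⟨
        0# + V (suc p) p 0 ∎
      product-formula p (suc r) n eq = +-cancelʳ (bz (suc (suc p)) * by r) _ _ (begin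
        bz (suc p) * by (suc r) + bz (suc (suc p)) * by r
          ≈⟨ coefficient-recurrence (suc p) r n eq ⟩
        ∑≤ n (λ j → binom (+ (n ∸ j)) r * YX n j)
          + ∑≤ (suc r) (λ h → binom (+ (n ∸ h)) (suc p) * ZX n h)
          ≈⟨ +-cong (U-step n r) (V-step n p r eq) ⟨
        (U n (suc r) + U n r) + (V n p (suc r) + V n (suc p) r)
          ≈⟨ solve 4 (λ a b c d → (a :+ b) :+ (c :+ d) := (a :+ c) :+ (b :+ d)) refl _ _ _ _ ⟩
        (U n (suc r) + V n p (suc r)) + (U n r + V n (suc p) r)
          ≈⟨ +-congˡ (product-formula (suc p) r n
               (≡.trans (cong suc (≡.sym (ℕ.+-suc p r))) eq)) ⟨
        (U n (suc r) + V n p (suc r)) + bz (suc (suc p)) * by r ∎)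

      -- Explains the factor binom(n, j) in the theorem: multiplying by n! turns each b_{n-j} b_j
      -- into binom(n, j) B_{n-j} B_j, on the left and in both sums alike.
      binom-ord : ∀ F G m j → binom (+ (m +ℕ j)) j * F m * G j
                  ≈ factorial (m +ℕ j) * (ord F m * ord G j)
      binom-ord F G m j = trans (*-congʳ (*-congʳ (binom-fact m j)))
        (solve 5 (λ a b c d e → (a :* (b :* c)) :* d :* e := a :* ((d :* b) :* (e :* c)))
          refl _ _ _ _ _)

      binom-ord-∸ : ∀ F G {n j} → j ≤ℕ n → binom (+ n) j * F (n ∸ j) * G j
                    ≈ factorial n * (ord F (n ∸ j) * ord G j)
      binom-ord-∸ F G {n} {j} j≤n = ≡.subst
        (λ k → binom (+ k) j * F (n ∸ j) * G j ≈ factorial k * (ord F (n ∸ j) * ord G j))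
        (ℕ.m∸n+n≡m j≤n) (binom-ord F G (n ∸ j) j)

    bernoulli-product : ∀ p q → let n = suc p +ℕ suc q in
      binom (+ n) (suc q) * Bz (suc p) * By (suc q)
      ≈ ∑≤ n (λ j → binom (+ n) j * binom (+ n -ℤ 1ℤ -ℤ + j) q * By (n ∸ j) * Bx j)
        + ∑≤ (suc q) (λ h → binom (+ n) h * binom (+ n -ℤ 1ℤ -ℤ + h) p
                             * (- 1#) ^ h * Bz (n ∸ h) * Bx h)
    bernoulli-product p q = begin
      binom (+ n) (suc q) * Bz (suc p) * By (suc q)
        ≈⟨ binom-ord Bz By (suc p) (suc q) ⟩
      factorial n * (bz (suc p) * by (suc q))
        ≈⟨ *-congˡ (product-formula p (suc q) n ≡.refl) ⟩
      factorial n * (U n (suc q) + V n p (suc q))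
        ≈⟨ distribˡ _ _ _ ⟩
      factorial n * U n (suc q) + factorial n * V n p (suc q)
        ≈⟨ +-cong (*-∑≤ (factorial n) n (u n q)) (*-∑≤ (factorial n) (suc q) (v n p)) ⟩
      ∑≤ n (λ j → factorial n * u n q j) + ∑≤ (suc q) (λ h → factorial n * v n p h)
        ≈⟨ +-cong (∑≤-cong n term₁) (∑≤-cong (suc q) term₂) ⟩
      ∑≤ n (λ j → binom (+ n) j * binom (+ n -ℤ 1ℤ -ℤ + j) q * By (n ∸ j) * Bx j)
        + ∑≤ (suc q) (λ h → binom (+ n) h * binom (+ n -ℤ 1ℤ -ℤ + h) p
                             * (- 1#) ^ h * Bz (n ∸ h) * Bx h) ∎
      where
      n = suc p +ℕ suc q
      term₁ : ∀ j → j ≤ℕ n → factorial n * u n q j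
              ≈ binom (+ n) j * binom (+ n -ℤ 1ℤ -ℤ + j) q * By (n ∸ j) * Bx j
      term₁ j j≤n = begin
        factorial n * (c′ * YX n j)
          ≈⟨ solve 3 (λ a b c → a :* (b :* c) := b :* (a :* c)) refl _ _ _ ⟩
        c′ * (factorial n * YX n j)
          ≈⟨ *-congˡ (binom-ord-∸ By Bx j≤n) ⟨
        c′ * (binom (+ n) j * By (n ∸ j) * Bx j)
          ≈⟨ solve 4 (λ a b c d → a :* (b :* c :* d) := b :* a :* c :* d) refl _ _ _ _ ⟩
        binom (+ n) j * c′ * By (n ∸ j) * Bx j ∎
        where c′ = binom (+ n -ℤ 1ℤ -ℤ + j) q
      term₂ : ∀ h → h ≤ℕ suc q → factorial n * v n p h
              ≈ binom (+ n) h * binom (+ n -ℤ 1ℤ -ℤ + h) p * (- 1#) ^ h * Bz (n ∸ h) * Bx h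
      term₂ h h≤q = begin
        factorial n * (c′ * ((- 1#) ^ h * (bz (n ∸ h) * bx h)))
          ≈⟨ solve 4 (λ a b c d → a :* (b :* (c :* d)) := b :* c :* (a :* d)) refl _ _ _ _ ⟩
        c′ * (- 1#) ^ h * (factorial n * (bz (n ∸ h) * bx h))
          ≈⟨ *-congˡ (binom-ord-∸ Bz Bx (ℕ.≤-trans h≤q (ℕ.m≤n+m (suc q) (suc p)))) ⟨
        c′ * (- 1#) ^ h * (binom (+ n) h * Bz (n ∸ h) * Bx h)
          ≈⟨ solve 5 (λ a e b c d → a :* e :* (b :* c :* d) := b :* a :* e :* c :* d) refl _ _ _ _ _ ⟩
        binom (+ n) h * c′ * (- 1#) ^ h * Bz (n ∸ h) * Bx h ∎
        where c′ = binom (+ n -ℤ 1ℤ -ℤ + h) p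

-- Integer parts of sums of real numbers.

open Defs using (ℝ; _≈_; _+_; _*_; -_; 1#; _^_; ∑≤; Floor; 𝓑; binom)
open Defs using (_-_; 0#; _≤_; mk≤; bound; seq; cauchy; fromℚ; fromℤ; pointwise; p≤∣p∣; IsFloor; fromℤ-≤)
open Defs using (module R; ℝ-commutativeRing; B; exp; one; _⊖_; t·_; generatingFunction)
open RationalBinomials using (/1-+)
open Algebra.Properties.Ring R.ring using (-0#≈0#)

half : ∀ {ε} → 0ℚ ℚ.< ε → 0ℚ ℚ.< ½ ℚ.* ε
half {ε} ε>0 = ℚ.positive⁻¹ (½ ℚ.* ε) {{ℚ.pos*pos⇒pos ½ ε {{ℚ.positive ε>0}}}}

half+half : ∀ ε → ½ ℚ.* ε ℚ.+ ½ ℚ.* ε ≡ ε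
half+half ε = ≡.trans (≡.sym (ℚ.*-distribʳ-+ ε ½ ½)) (ℚ.*-identityˡ ε)

eventually-+ : ∀ {f g : ℕ → ℚ} {ε} → 0ℚ ℚ.< ε →
  (∀ δ → 0ℚ ℚ.< δ → ∃ λ N → ∀ n → N ≤ℕ n → f n ℚ.< δ) →
  (∀ δ → 0ℚ ℚ.< δ → ∃ λ N → ∀ n → N ≤ℕ n → g n ℚ.< δ) →
  ∃ λ N → ∀ n → N ≤ℕ n → f n ℚ.+ g n ℚ.< ε
eventually-+ {f} {g} {ε} ε>0 hf hg =
  let M , F = hf (½ ℚ.* ε) (half ε>0)
      N , G = hg (½ ℚ.* ε) (half ε>0)
  in M ⊔ N , λ n le → ≡.subst (f n ℚ.+ g n ℚ.<_) (half+half ε)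
       (ℚ.+-mono-< (F n (ℕ.≤-trans (ℕ.m≤m⊔n M N) le)) (G n (ℕ.≤-trans (ℕ.m≤n⊔m M N) le)))

-- Constructively valid because a single rational comparison suffices. Beyond an index N the
-- sequence `y` moves by less than ε/2; if y_N - k < ε/2, then y stays below k + ε, and otherwise y
-- stays above k from N on, contrary to the hypothesis.
≰⇒≥ : ∀ {k y} → ¬ (fromℤ k ≤ y) → y ≤ fromℤ k
≰⇒≥ {k} {y} k≰y .bound ε ε>0 with cauchy y (½ ℚ.* ε) (half ε>0)
... | N , h with seq y N ℚ.- k / 1 ℚ.<? ½ ℚ.* ε
...   | yes lt = N , λ n N≤n → ≡.subst₂ ℚ._<_
  (telescope (seq y n) (seq y N) (k / 1)) (half+half ε)
  (ℚ.+-mono-< (ℚ.≤-<-trans (p≤∣p∣ _) (h n N N≤n ℕ.≤-refl)) lt)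
  where
  telescope : ∀ a b c → (a ℚ.- b) ℚ.+ (b ℚ.- c) ≡ a ℚ.- c
  telescope = solve 3 (λ a b c → (a :- b) :+ (b :- c) := a :- c) ≡.refl
    where open Data.Rational.Solver.+-*-Solver
...   | no ¬lt = ⊥-elim (k≰y (mk≤ λ ε′ ε′>0 → N , λ n N≤n →
  ℚ.<-trans (≡.subst₂ ℚ._<_ (telescope (seq y n) (seq y N) (k / 1)) (ℚ.+-inverseʳ (½ ℚ.* ε))
    (ℚ.+-mono-<-≤ (ℚ.≤-<-trans (p≤∣p∣ _) (h N n ℕ.≤-refl N≤n))
                  (ℚ.neg-antimono-≤ (ℚ.≮⇒≥ ¬lt)))) ε′>0))
  where
  telescope : ∀ a b c → (b ℚ.- a) ℚ.+ (ℚ.- (b ℚ.- c)) ≡ c ℚ.- a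
  telescope = solve 3 (λ a b c → (b :- a) :+ (:- (b :- c)) := c :- a) ≡.refl
    where open Data.Rational.Solver.+-*-Solver

fromℤ-+-≤ : ∀ {m k x y} → fromℤ m ≤ x → fromℤ k ≤ y → fromℤ (m ℤ.+ k) ≤ x + y
fromℤ-+-≤ {m} {k} {x} {y} m≤x k≤y .bound ε ε>0 =
  let N , h = eventually-+ ε>0 (bound m≤x) (bound k≤y)
  in N , λ n N≤n → ≡.subst (ℚ._< ε)
       (≡.trans (arrange (m / 1) (seq x n) (k / 1) (seq y n))
         (cong (ℚ._- (seq x n ℚ.+ seq y n)) (≡.sym (/1-+ m k)))) (h n N≤n)
  where
  arrange : ∀ a b c d → (a ℚ.- b) ℚ.+ (c ℚ.- d) ≡ (a ℚ.+ c) ℚ.- (b ℚ.+ d)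
  arrange = solve 4 (λ a b c d → (a :- b) :+ (c :- d) := (a :+ c) :- (b :+ d)) ≡.refl
    where open Data.Rational.Solver.+-*-Solver

fromℤ-+-cancel-≤ : ∀ {m k x y} → fromℤ (m ℤ.+ k) ≤ x + y → y ≤ fromℤ k → fromℤ m ≤ x
fromℤ-+-cancel-≤ {m} {k} {x} {y} m+k≤x+y y≤k .bound ε ε>0 =
  let N , h = eventually-+ ε>0 (bound m+k≤x+y) (bound y≤k)
  in N , λ n N≤n → ≡.subst (ℚ._< ε)
       (≡.trans (cong (λ i → (i ℚ.- (seq x n ℚ.+ seq y n)) ℚ.+ (seq y n ℚ.- k / 1)) (/1-+ m k))
         (arrange (m / 1) (seq x n) (k / 1) (seq y n))) (h n N≤n)
  where
  arrange : ∀ a b c d → ((a ℚ.+ c) ℚ.- (b ℚ.+ d)) ℚ.+ (d ℚ.- c) ≡ a ℚ.- b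
  arrange = solve 4 (λ a b c d → ((a :+ c) :- (b :+ d)) :+ (d :- c) := a :- b) ≡.refl
    where open Data.Rational.Solver.+-*-Solver

suc≰ : ∀ i → ¬ (ℤ.suc i ℤ.≤ i)
suc≰ i le = ℤ.<-irrefl ≡.refl (ℤ.suc[i]≤j⇒i<j le)

-- Only comparisons of integers are decided. Maximality of `k` does not directly yield y < k + 1,
-- but the weak bound supplied by `≰⇒≥` is enough.
floor-+ : ∀ {x y m k l} → IsFloor x m → IsFloor y k → IsFloor (x + y) l →
  l ≡ m ℤ.+ k ⊎ l ≡ ℤ.suc (m ℤ.+ k)
floor-+ {x} {y} {m} {k} {l} (m≤x , m-max) (k≤y , k-max) (l≤x+y , l-max)
  with l ℤ.≤? m ℤ.+ k
... | yes l≤m+k = inj₁ (ℤ.≤-antisym l≤m+k (l-max _ (fromℤ-+-≤ {m} {k} {x} {y} m≤x k≤y)))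
... | no  l≰m+k with l ℤ.≤? ℤ.suc (m ℤ.+ k)
...   | yes l≤ = inj₂ (ℤ.≤-antisym l≤ (ℤ.i<j⇒suc[i]≤j (ℤ.≰⇒> l≰m+k)))
-- Here m + k + 2 ≤ l, hence (m + 1) + (k + 1) ≤ x + y; with y ≤ k + 1 this gives m + 1 ≤ x, against
-- the maximality of `m`.
...   | no  l≰ = ⊥-elim (suc≰ m (m-max (ℤ.suc m)
          (fromℤ-+-cancel-≤ {ℤ.suc m} {ℤ.suc k} {x} {y}
            (fromℤ-≤ {x = x + y} (≡.subst (ℤ._≤ l) (arrange m k) (ℤ.i<j⇒suc[i]≤j (ℤ.≰⇒> l≰))) l≤x+y)
            (≰⇒≥ {ℤ.suc k} {y} λ k<y → suc≰ k (k-max _ k<y)))))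
  where
  arrange : ∀ m k → ℤ.suc (ℤ.suc (m ℤ.+ k)) ≡ ℤ.suc m ℤ.+ ℤ.suc k
  arrange = solve 2 (λ m k → con 1ℤ :+ (con 1ℤ :+ (m :+ k)) := (con 1ℤ :+ m) :+ (con 1ℤ :+ k)) ≡.refl
    where open Data.Integer.Solver.+-*-Solver

fractional-+ : ∀ x y {m k l} → l ≡ m ℤ.+ k ⊎ l ≡ ℤ.suc (m ℤ.+ k) →
  let z = (x + y) - fromℤ l in
  z ≈ (x - fromℤ m) + (y - fromℤ k) ⊎ z + 1# ≈ (x - fromℤ m) + (y - fromℤ k)
fractional-+ x y {m} {k} (inj₁ ≡.refl) =
  inj₁ (pointwise {(x + y) - fromℤ (m ℤ.+ k)} {(x - fromℤ m) + (y - fromℤ k)} λ n →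
    ≡.trans (cong (λ i → (seq x n ℚ.+ seq y n) ℚ.- i) (/1-+ m k))
      (arrange (seq x n) (seq y n) (m / 1) (k / 1)))
  where
  arrange : ∀ a b c d → (a ℚ.+ b) ℚ.- (c ℚ.+ d) ≡ (a ℚ.- c) ℚ.+ (b ℚ.- d)
  arrange = solve 4 (λ a b c d → (a :+ b) :- (c :+ d) := (a :- c) :+ (b :- d)) ≡.refl
    where open Data.Rational.Solver.+-*-Solver
fractional-+ x y {m} {k} (inj₂ ≡.refl) =
  inj₂ (pointwise {((x + y) - fromℤ (ℤ.suc (m ℤ.+ k))) + 1#} {(x - fromℤ m) + (y - fromℤ k)} λ n →
    ≡.trans (cong (λ i → ((seq x n ℚ.+ seq y n) ℚ.- i) ℚ.+ 1ℚ)
        (≡.trans (/1-+ 1ℤ (m ℤ.+ k)) (cong (1ℚ ℚ.+_) (/1-+ m k))))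
      (arrange (seq x n) (seq y n) (m / 1) (k / 1)))
  where
  arrange : ∀ a b c d → ((a ℚ.+ b) ℚ.- (1ℚ ℚ.+ (c ℚ.+ d))) ℚ.+ 1ℚ ≡ (a ℚ.- c) ℚ.+ (b ℚ.- d)
  arrange = solve 4 (λ a b c d → ((a :+ b) :- (con 1ℚ :+ (c :+ d))) :+ con 1ℚ := (a :- c) :+ (b :- d)) ≡.refl
    where open Data.Rational.Solver.+-*-Solver

-- Specialisation to the real Bernoulli polynomials.

fromℚ-isRingHomomorphism : IsRingHomomorphism ℚ.+-*-rawRing R.rawRing fromℚ
fromℚ-isRingHomomorphism = record
  { isSemiringHomomorphism = record
    { isNearSemiringHomomorphism = record
      { +-isMonoidHomomorphism = record
        { isMagmaHomomorphism = record
          { isRelHomomorphism = record { cong = λ { ≡.refl → R.refl } }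
          ; homo = λ a b → pointwise {fromℚ (a ℚ.+ b)} {fromℚ a + fromℚ b} λ _ → ≡.refl
          }
        ; ε-homo = R.refl
        }
      ; *-homo = λ a b → pointwise {fromℚ (a ℚ.* b)} {fromℚ a * fromℚ b} λ _ → ≡.refl
      }
    ; 1#-homo = R.refl
    }
  ; -‿homo = λ a → pointwise {fromℚ (ℚ.- a)} { - fromℚ a} λ _ → ≡.refl
  }

open ℚ-Algebra ℝ-commutativeRing fromℚ fromℚ-isRingHomomorphism
  using (ord; ord-⊠; ord-injective; cauchyProduct; ∑≤-cong; ord-X⊠E-zero; ord-X⊠E-suc; bernoulli-product)
  renaming (1/! to inverseFactorial)
open Hurwitz ℝ-commutativeRing using (_⊠_; X; _≋_)
open Exponentials ℝ-commutativeRing using (E; E-1; E-1≋E; IsBernoulli)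

ord-E-1 : ord E-1 ≋ exp 1# ⊖ one
ord-E-1 zero    = pointwise {ord E-1 0} {(exp 1# ⊖ one) 0} λ _ → ≡.refl
ord-E-1 (suc n) = begin
  1# * i                ≈⟨ R.*-congʳ (R.trans (R.sym (R.+-identityˡ 1#)) (E-1≋E (suc n))) ⟩
  exp 1# (suc n)        ≈⟨ R.+-identityʳ _ ⟨
  exp 1# (suc n) + 0#   ≈⟨ R.+-congˡ -0#≈0# ⟨
  exp 1# (suc n) - 0#   ∎
  where
  open Relation.Binary.Reasoning.Setoid R.setoid
  i = inverseFactorial (suc n)

-- `generatingFunction` is this equation in ordinary coefficients; `ord-injective` carries it over
-- to exponential ones.
B-isBernoulli : ∀ x → IsBernoulli x (λ n → B n x)
B-isBernoulli x = ord-injective λ n → begin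
  ord (E-1 ⊠ Bx) n                      ≈⟨ ord-⊠ E-1 Bx n ⟩
  cauchyProduct (ord E-1) (ord Bx) n
    ≈⟨ ∑≤-cong n {λ k → ord E-1 k * ord Bx (n ∸ k)} {λ k → (exp 1# ⊖ one) k * ord Bx (n ∸ k)}
         (λ k _ → R.*-congʳ (ord-E-1 k)) ⟩
  cauchyProduct (exp 1# ⊖ one) (ord Bx) n ≈⟨ generatingFunction x n ⟩
  (t· exp x) n                          ≈⟨ ord-X⊠E n ⟨
  ord (X ⊠ E x) n                       ∎
  where
  open Relation.Binary.Reasoning.Setoid R.setoid
  Bx : ℕ → ℝ
  Bx n = B n x
  ord-X⊠E : ord (X ⊠ E x) ≋ t· exp x
  ord-X⊠E zero    = ord-X⊠E-zero x
  ord-X⊠E (suc n) = ord-X⊠E-suc x n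

theorem3 : (X Y : ℝ) (⌊X⌋ : Floor X) (⌊Y⌋ : Floor Y) (⌊X+Y⌋ : Floor (X + Y))
    (p q : ℕ) → 1 ≤ℕ p → 1 ≤ℕ q →
    binom (+ (p +ℕ q)) q * 𝓑 p (X + Y) ⌊X+Y⌋ * 𝓑 q Y ⌊Y⌋
    ≈ ∑[ j ≤ p +ℕ q ] (binom (+ (p +ℕ q)) j * binom (+ (p +ℕ q) -ℤ 1ℤ -ℤ + j) (q ∸ 1)
    * 𝓑 (p +ℕ q ∸ j) Y ⌊Y⌋ * 𝓑 j X ⌊X⌋)
    + ∑[ h ≤ q ] (binom (+ (p +ℕ q)) h * binom (+ (p +ℕ q) -ℤ 1ℤ -ℤ + h) (p ∸ 1)
    * (- 1#) ^ h * 𝓑 (p +ℕ q ∸ h) (X + Y) ⌊X+Y⌋ * 𝓑 h X ⌊X⌋)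
theorem3 X Y (m , ⌊X⌋) (k , ⌊Y⌋) (l , ⌊X+Y⌋) (suc p) (suc q) _ _ =
  bernoulli-product (B-isBernoulli (X - fromℤ m)) (B-isBernoulli (Y - fromℤ k))
    -- The series at 0 is t/(e^t - 1), the auxiliary factor that clears the denominators.
    (B-isBernoulli ((X + Y) - fromℤ l)) (B-isBernoulli 0#)
    (fractional-+ X Y {m} {k} (floor-+ {X} {Y} ⌊X⌋ ⌊Y⌋ ⌊X+Y⌋)) p q
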